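{- Let $M$ be a binary matroid on ground set $V$. (1) $M$ is bipartite iff $M+V$ is an even $\Delta$-matroid. (2) $M$ is Eulerian iff $M\bar{*}V$ is an even $\Delta$-matroid.
   Context: A matroid is bipartite if every circuit has even cardinality, and Eulerian if $V$ is a disjoint union of circuits. The matroid $M$ is identified with the set system $(V,\mathcal{B})$ of its bases. For a set system $N=(V,D)$ and $X\subseteq V$: loop complementation $N+X=(V,D')$ with $Y\in D'$ iff the number of $W\in D$ with $Y\setminus X\subseteq W\subseteq Y$ is odd; dual pivot $N\bar{*}X=(V,D'')$ with $Y\in D''$ iff the number of $W\in D$ with $Y\subseteq W\subseteq Y\cup X$ is odd. A set system is even if all its members have cardinalities of the same parity. A $\Delta$-matroid is a nonempty-family set system such that for all $X,Y\in D$, $x\in X\triangle Y$ there is $y\in X\triangle Y$ (possibly $y=x$) with $X\triangle\{x,y\}\in D$. -}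

module Defs where

open import Data.Nat using (ℕ; zero; suc; _%_)
open import Data.Nat.Divisibility using (_∣_)
open import Data.Bool using (Bool; true; false; _∧_; _xor_; if_then_else_)
open import Data.Fin using (Fin)
open import Data.Fin.Subset
  using (Subset; _∈_; _∉_; _⊆_; _⊂_; _∩_; _∪_; _─_; _-_; ⁅_⁆; ∣_∣; ⊥; ⊤; outside; inside)
open import Data.Fin.Subset.Properties using (_⊆?_)
open import Data.Vec using (Vec; []; _∷_; foldr′; zipWith; tabulate; replicate)
open import Data.List using (List; []; _∷_; map; _++_; length; filterᵇ)
open import Data.List.Relation.Unary.All using (All)
open import Data.List.Relation.Unary.AllPairs using (AllPairs)
open import Data.Product using (Σ; ∃; ∃-syntax; _×_; _,_)
open import Relation.Binary.PropositionalEquality using (_≡_)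
open import Relation.Nullary using (¬_; Dec; yes; no)
open import Relation.Nullary.Decidable using (isYes)
open import Function.Bundles using (_⇔_)

SetSystem : ℕ → Set
SetSystem n = Subset n → Bool

_∈ₛ_ : {n : ℕ} → Subset n → SetSystem n → Set
Y ∈ₛ D = D Y ≡ true

allSubsets : (n : ℕ) → List (Subset n)
allSubsets zero    = [] ∷ []
allSubsets (suc n) = map (outside ∷_) (allSubsets n) ++ map (inside ∷_) (allSubsets n)

_△_ : {n : ℕ} → Subset n → Subset n → Subset n
X △ Y = (X ─ Y) ∪ (Y ─ X)

_+ₗ_ : {n : ℕ} → SetSystem n → Subset n → SetSystem n
(D +ₗ X) Y =
  (length (filterᵇ (λ W → isYes ((Y ─ X) ⊆? W) ∧ isYes (W ⊆? Y) ∧ D W)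
                  (allSubsets _)) % 2) Data.Nat.≡ᵇ 1

_*̄_ : {n : ℕ} → SetSystem n → Subset n → SetSystem n
(D *̄ X) Y =
  (length (filterᵇ (λ W → isYes (Y ⊆? W) ∧ isYes (W ⊆? (Y ∪ X)) ∧ D W)
                  (allSubsets _)) % 2) Data.Nat.≡ᵇ 1

IsEven : {n : ℕ} → SetSystem n → Set
IsEven D = ∀ X Y → X ∈ₛ D → Y ∈ₛ D → ∣ X ∣ % 2 ≡ ∣ Y ∣ % 2

IsΔMatroid : {n : ℕ} → SetSystem n → Set
IsΔMatroid D =
  (∃[ X ] X ∈ₛ D) ×
  (∀ X Y x → X ∈ₛ D → Y ∈ₛ D → x ∈ (X △ Y) →
     ∃[ y ] (y ∈ (X △ Y) × (X △ (⁅ x ⁆ ∪ ⁅ y ⁆)) ∈ₛ D))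

-- Matroids, identified with their set system of bases

IsMatroid : {n : ℕ} → SetSystem n → Set
IsMatroid B =
  (∃[ X ] X ∈ₛ B) ×
  (∀ B₁ B₂ x → B₁ ∈ₛ B → B₂ ∈ₛ B → x ∈ (B₁ ─ B₂) →
     ∃[ y ] (y ∈ (B₂ ─ B₁) × ((B₁ - x) ∪ ⁅ y ⁆) ∈ₛ B))

Independent : {n : ℕ} → SetSystem n → Subset n → Set
Independent B I = ∃[ X ] (X ∈ₛ B × I ⊆ X)

Circuit : {n : ℕ} → SetSystem n → Subset n → Set
Circuit B C = ¬ Independent B C × (∀ D → D ⊂ C → Independent B D)

Bipartite : {n : ℕ} → SetSystem n → Set
Bipartite B = ∀ C → Circuit B C → 2 ∣ ∣ C ∣

Eulerian : {n : ℕ} → SetSystem n → Set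
Eulerian {n} B =
  ∃[ Cs ] (All (Circuit B) Cs ×
           AllPairs (λ C C′ → C ∩ C′ ≡ ⊥) Cs ×
           Data.List.foldr _∪_ ⊥ Cs ≡ ⊤)

-- Binary matroids: representable over GF(2) (Bool with xor as addition).
-- A matrix with m rows and columns indexed by V = Fin n.

Matrix₂ : ℕ → ℕ → Set
Matrix₂ m n = Fin m → Fin n → Bool

column : {m n : ℕ} → Matrix₂ m n → Fin n → Vec Bool m
column A j = tabulate (λ i → A i j)

colSum : {m n : ℕ} → Matrix₂ m n → Subset n → Vec Bool m
colSum A S = tabulate (λ i → foldr′ _xor_ false (zipWith _∧_ S (tabulate (A i))))

LinIndep : {m n : ℕ} → Matrix₂ m n → Subset n → Set
LinIndep {m} A I = ∀ S → S ⊆ I → colSum A S ≡ replicate m false → S ≡ ⊥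

Spans : {m n : ℕ} → Matrix₂ m n → Subset n → Set
Spans A I = ∀ j → ∃[ S ] (S ⊆ I × colSum A S ≡ column A j)

ColumnBasis : {m n : ℕ} → Matrix₂ m n → Subset n → Set
ColumnBasis A I = LinIndep A I × Spans A I

IsBinary : {n : ℕ} → SetSystem n → Set
IsBinary {n} B = ∃[ m ] Σ (Matrix₂ m n) (λ A → ∀ X → (X ∈ₛ B ⇔ ColumnBasis A X))

{-# OPTIONS --safe #-}
module Submission where

-- Let K be the cycle space of M and L = K^⊥ its cocycle space. Then L × K is a Lagrangian subspace of (GF(2)²)^n for
-- the symplectic form. For a choice t of one nonzero vector of GF(2)² in every coordinate, let N(t) = 1 if L × K meets
-- the product of the lines spanned by t only in 0, and N(t) = 0 otherwise. When one coordinate of t runs through the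
-- three nonzero vectors, the values of N add up to 0 mod 2. W is a basis of M iff N is 1 at the vector that is (0,1)
-- on W and (1,0) off W; so expanding coordinate by coordinate, Y lies in M + V iff N = 1 at "(1,1) on Y, (1,0) off Y",
-- and in M *̄ V iff N = 1 at "(0,1) on Y, (1,1) off Y". Isotropy yields the exchange axiom for every such two-letter
-- family. The family is even iff no two of its members differ in one element, and since v · k = 0 on L × K, this holds
-- iff the constant vector of the unused letter is orthogonal to L × K, that is, iff V ∈ K^⊥ (all cycles are even, M is
-- bipartite), respectively V ∈ L^⊥ = K (M is Eulerian).

open import Defs
open import Data.Bool using (Bool; true; false; not; _∧_; _∨_; _xor_; if_then_else_)
open import Data.Bool.Properties as Bool using (xor-comm; xor-same; xor-identityʳ; ∧-comm; ¬-not)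
open import Data.Fin using (Fin; zero; suc; _≟_; combine)
open import Data.Fin.Properties using (all?; any?; combine-injective; combine-surjective; punchOut-injective; injective⇒≤)
open import Data.Fin.Subset using (Subset; _∈_; _∉_; _⊆_; _⊂_; _∩_; _∪_; _─_; ⁅_⁆; ∣_∣; ⊥; ⊤)
open import Data.Fin.Subset.Induction using (⊂-wellFounded; Acc; acc)
open import Data.Fin.Subset.Properties using (_⊆?_; anySubset?; _⊂?_; _∈?_; nonempty?; Empty-unique; ⊆-antisym; ⊆-⊂-trans; x∈p∩q⁻; x∈⁅x⁆; x∈⁅y⁆⇒x≡y; ∈⊤; p⊆p∪q; q⊆p∪q; x∈p∪q⁻; ∪-idem; ∩-identityʳ; ∩-zeroʳ; ∩-distribˡ-∪)
open import Data.List as List using (List; []; _∷_; _++_; length; filterᵇ; allFin)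
open import Data.List.Membership.Propositional using () renaming (_∈_ to _∈ˡ_)
open import Data.List.Membership.Propositional.Properties using (∈-allFin)
open import Data.List.Relation.Unary.All as All using (All; []; _∷_)
open import Data.List.Relation.Unary.AllPairs using (AllPairs; []; _∷_)
open import Data.List.Relation.Unary.Any using (here; there)
open import Data.Nat using (ℕ; zero; suc; _+_; _^_; _%_; _≡ᵇ_)
open import Data.Nat.Divisibility using (_∣_; m%n≡0⇒n∣m; n∣m⇒m%n≡0)
open import Data.Nat.Properties using (1+n≰n)
open import Data.Product using (∃-syntax; ∃₂; _×_; _,_; proj₁; proj₂)
open import Data.Sum using (inj₁; inj₂)
open import Data.Vec as Vec using (Vec; []; _∷_; here; there; _[_]≔_; lookup; tabulate; zipWith; replicate; foldr′)
open import Data.Vec.Functional using (updateAt)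
open import Data.Vec.Functional.Properties using (updateAt-updates; updateAt-minimal)
open import Data.Vec.Properties using (lookup-map; lookup-zipWith; lookup-replicate; lookup∘updateAt; lookup∘updateAt′; lookup∘tabulate; tabulate∘lookup; tabulate-cong; []=⇒lookup; lookup⇒[]=; ≡-dec)
open import Function using (_∘_; const)
open import Function.Bundles using (_⇔_; mk⇔; Equivalence)
open import Relation.Binary.PropositionalEquality using (_≡_; _≢_; refl; sym; trans; cong; cong₂; subst; module ≡-Reasoning)
open import Relation.Nullary using (¬_; Dec; yes; no; does; contradiction; ¬?; _×-dec_)
open import Relation.Nullary.Decidable using (isYes; isYes≗does; map′; decidable-stable)

private
  variable
    m n : ℕ

-- Vectors over GF(2)

infixl 6 _⊕_

_⊕_ : Subset n → Subset n → Subset n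
_⊕_ = zipWith _xor_

par : Subset n → Bool
par = foldr′ _xor_ false

dot : Subset n → Subset n → Bool
dot u w = par (u ∩ w)

vec-ext : {A : Set} {u w : Vec A n} → (∀ i → lookup u i ≡ lookup w i) → u ≡ w
vec-ext {u = u} {w} h = trans (sym (tabulate∘lookup u)) (trans (tabulate-cong h) (tabulate∘lookup w))

lookup-⊕ : ∀ (u w : Subset n) i → lookup (u ⊕ w) i ≡ lookup u i xor lookup w i
lookup-⊕ u w i = lookup-zipWith _xor_ i u w

lookup-⊥ : ∀ (i : Fin n) → lookup ⊥ i ≡ false
lookup-⊥ i = lookup-replicate i false

lookup-⁅⁆ : ∀ (x : Fin n) → lookup ⁅ x ⁆ x ≡ true
lookup-⁅⁆ x = []=⇒lookup (x∈⁅x⁆ x)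

lookup-⁅⁆-≢ : ∀ {x i : Fin n} → i ≢ x → lookup ⁅ x ⁆ i ≡ false
lookup-⁅⁆-≢ {x = x} {i} i≢x = ¬-not λ eq → i≢x (x∈⁅y⁆⇒x≡y x (lookup⇒[]= i ⁅ x ⁆ eq))

xor-interchange : ∀ a b c d → (a xor b) xor (c xor d) ≡ (a xor c) xor (b xor d)
xor-interchange false b false d = refl
xor-interchange false b true  d = sym (trans (cong not (xor-comm b d)) (trans (Bool.not-distribˡ-xor d b) (xor-comm (not d) b)))
xor-interchange true  b false d = sym (Bool.not-distribˡ-xor b d)
xor-interchange true  b true  d = trans (sym (Bool.not-distribˡ-xor b (not d)))
  (trans (cong not (sym (Bool.not-distribʳ-xor b d))) (Bool.not-involutive _))

xor-false⇒≡ : ∀ {a b} → a xor b ≡ false → a ≡ b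
xor-false⇒≡ {false} {false} _ = refl
xor-false⇒≡ {true}  {true}  _ = refl

⊕≡⊥⇒≡ : {u w : Subset n} → u ⊕ w ≡ ⊥ → u ≡ w
⊕≡⊥⇒≡ {u = u} {w} eq = vec-ext λ i → xor-false⇒≡
  (trans (sym (lookup-⊕ u w i)) (trans (cong (λ z → lookup z i) eq) (lookup-⊥ i)))

par-⊕ : ∀ (u w : Subset n) → par (u ⊕ w) ≡ par u xor par w
par-⊕ []      []      = refl
par-⊕ (x ∷ u) (y ∷ w) = trans (cong ((x xor y) xor_) (par-⊕ u w)) (xor-interchange x y (par u) (par w))

par-⊥ : ∀ n → par {n} ⊥ ≡ false
par-⊥ zero    = refl
par-⊥ (suc n) = par-⊥ n

par-cong : ∀ (u w : Subset n) → (∀ i → lookup u i ≡ lookup w i) → par u ≡ par w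
par-cong u w h = cong par (vec-ext {u = u} {w} h)

par-zero : ∀ (z : Subset n) → (∀ i → lookup z i ≡ false) → par z ≡ false
par-zero {n} z h = trans (par-cong z ⊥ λ i → trans (h i) (sym (lookup-⊥ i))) (par-⊥ n)

par-single : ∀ (z : Subset n) y → (∀ i → i ≢ y → lookup z i ≡ false) → par z ≡ lookup z y
par-single (b ∷ z) zero    h = trans (cong (b xor_) (par-zero z λ i → h (suc i) λ ())) (xor-identityʳ b)
par-single (b ∷ z) (suc y) h rewrite h zero (λ ()) = par-single z y λ i i≢y → h (suc i) λ { refl → i≢y refl }

dot-⊕ˡ : ∀ (u w z : Subset n) → dot (u ⊕ w) z ≡ dot u z xor dot w z
dot-⊕ˡ u w z = trans (cong par (distrib u w z)) (par-⊕ (u ∩ z) (w ∩ z))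
  where
  distrib : ∀ {n} (u w z : Subset n) → (u ⊕ w) ∩ z ≡ (u ∩ z) ⊕ (w ∩ z)
  distrib []      []      []      = refl
  distrib (x ∷ u) (y ∷ w) (b ∷ z) = cong₂ _∷_ (Bool.∧-distribʳ-xor b x y) (distrib u w z)

dot-comm : ∀ (u w : Subset n) → dot u w ≡ dot w u
dot-comm u w = par-cong (u ∩ w) (w ∩ u) λ i → trans (lookup-zipWith _∧_ i u w)
  (trans (∧-comm (lookup u i) (lookup w i)) (sym (lookup-zipWith _∧_ i w u)))

dot-⊥ˡ : ∀ (w : Subset n) → dot ⊥ w ≡ false
dot-⊥ˡ w = par-zero (⊥ ∩ w) λ i → trans (lookup-zipWith _∧_ i ⊥ w) (cong (_∧ lookup w i) (lookup-⊥ i))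

dot-⊕ʳ : ∀ (u w z : Subset n) → dot u (w ⊕ z) ≡ dot u w xor dot u z
dot-⊕ʳ u w z = trans (dot-comm u (w ⊕ z)) (trans (dot-⊕ˡ w z u) (cong₂ _xor_ (dot-comm w u) (dot-comm z u)))

dot-⊥ʳ : ∀ (u : Subset n) → dot u ⊥ ≡ false
dot-⊥ʳ u = trans (dot-comm u ⊥) (dot-⊥ˡ u)

dot-⊤ʳ : ∀ (u : Subset n) → dot u ⊤ ≡ par u
dot-⊤ʳ u = cong par (∩-identityʳ u)

dot-⁅⁆ʳ : ∀ (u : Subset n) j → dot u ⁅ j ⁆ ≡ lookup u j
dot-⁅⁆ʳ u j = trans (par-single (u ∩ ⁅ j ⁆) j off-j) (trans (lookup-zipWith _∧_ j u ⁅ j ⁆)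
  (trans (cong (lookup u j ∧_) (lookup-⁅⁆ j)) (Bool.∧-identityʳ _)))
  where
  off-j : ∀ i → i ≢ j → lookup (u ∩ ⁅ j ⁆) i ≡ false
  off-j i i≢j = trans (lookup-zipWith _∧_ i u ⁅ j ⁆) (trans (cong (lookup u i ∧_) (lookup-⁅⁆-≢ i≢j)) (Bool.∧-zeroʳ _))

dot-disjoint : ∀ (u w : Subset n) → (∀ i → lookup w i ≡ true → lookup u i ≡ false) → dot u w ≡ false
dot-disjoint u w h = par-zero (u ∩ w) λ i → trans (lookup-zipWith _∧_ i u w) (disjoint i)
  where
  disjoint : ∀ i → lookup u i ∧ lookup w i ≡ false
  disjoint i with lookup w i in eq
  ... | true  = cong (_∧ true) (h i eq)
  ... | false = Bool.∧-zeroʳ _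

⊕-self : ∀ (u : Subset n) → u ⊕ u ≡ ⊥
⊕-self u = vec-ext λ i → trans (lookup-⊕ u u i) (trans (xor-same (lookup u i)) (sym (lookup-⊥ i)))

-- Toggling `j` affects no other element, and `j` is in the result only if it was missing from `S`.
-- Applied to a cycle `S`, this expresses column `j` through columns in `J`.
⊕⁅⁆-⊆ : ∀ {S J : Subset n} {j} → (∀ i → i ≢ j → i ∈ S → i ∈ J) → (lookup S j ≡ false → j ∈ J) → S ⊕ ⁅ j ⁆ ⊆ J
⊕⁅⁆-⊆ {S = S} {J} {j} h h-j {i} i∈ with i ≟ j
... | yes refl = h-j (flip-false (trans (sym (cong (lookup S j xor_) (lookup-⁅⁆ j))) (trans (sym (lookup-⊕ S ⁅ j ⁆ j)) ([]=⇒lookup i∈))))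
  where
  flip-false : ∀ {b} → b xor true ≡ true → b ≡ false
  flip-false {false} _ = refl
... | no i≢j = h i i≢j (lookup⇒[]= i S (trans (sym (xor-identityʳ _))
  (trans (cong (lookup S i xor_) (sym (lookup-⁅⁆-≢ i≢j))) (trans (sym (lookup-⊕ S ⁅ j ⁆ i)) ([]=⇒lookup i∈)))))

-- The matrix with columns `S j` applied to the coefficient vector `w`.
comb : Subset m → (Fin m → Subset n) → Subset n
comb []          S = ⊥
comb (true ∷ w)  S = S zero ⊕ comb w (S ∘ suc)
comb (false ∷ w) S = comb w (S ∘ suc)

-- Adjointness: `tabulate (dot u ∘ S)` is the transposed matrix applied to `u`.
dot-comb : ∀ (u : Subset n) (w : Subset m) S → dot u (comb w S) ≡ dot (tabulate (dot u ∘ S)) w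
dot-comb u []          S = dot-⊥ʳ u
dot-comb u (true ∷ w)  S = trans (dot-⊕ʳ u (S zero) (comb w (S ∘ suc)))
  (cong₂ _xor_ (sym (Bool.∧-identityʳ (dot u (S zero)))) (dot-comb u w (S ∘ suc)))
dot-comb u (false ∷ w) S = trans (dot-comb u w (S ∘ suc))
  (cong (_xor dot (tabulate (dot u ∘ S ∘ suc)) w) (sym (Bool.∧-zeroʳ (dot u (S zero)))))

comb-zero : ∀ (w : Subset m) (S : Fin m → Subset n) i → (∀ j → lookup (S j) i ≡ false) → lookup (comb w S) i ≡ false
comb-zero []          S i h = lookup-⊥ i
comb-zero (true ∷ w)  S i h = trans (lookup-⊕ (S zero) _ i) (cong₂ _xor_ (h zero) (comb-zero w (S ∘ suc) i (h ∘ suc)))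
comb-zero (false ∷ w) S i h = comb-zero w (S ∘ suc) i (h ∘ suc)

∉⇒lookup : ∀ {S : Subset n} {i} → i ∉ S → lookup S i ≡ false
∉⇒lookup {S = S} {i} i∉ = ¬-not λ eq → i∉ (lookup⇒[]= i S eq)

-- Disjoint unions

∩≡⊥⇒∪≡⊕ : ∀ {C R : Subset n} → C ∩ R ≡ ⊥ → C ∪ R ≡ C ⊕ R
∩≡⊥⇒∪≡⊕ {C = C} {R} eq = vec-ext λ i → trans (lookup-zipWith _∨_ i C R) (trans
  (agree (lookup C i) (lookup R i) (trans (sym (lookup-zipWith _∧_ i C R)) (trans (cong (λ Z → lookup Z i) eq) (lookup-⊥ i))))
  (sym (lookup-⊕ C R i)))
  where
  agree : ∀ a b → a ∧ b ≡ false → a ∨ b ≡ a xor b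
  agree false b     _ = refl
  agree true  false _ = refl

disjoint-⋃ : ∀ {C : Subset n} {Cs} → All (λ C′ → C ∩ C′ ≡ ⊥) Cs → C ∩ List.foldr _∪_ ⊥ Cs ≡ ⊥
disjoint-⋃ {C = C} []                = ∩-zeroʳ C
disjoint-⋃ {C = C} {C′ ∷ Cs} (p ∷ ps) = trans (∩-distribˡ-∪ C C′ (List.foldr _∪_ ⊥ Cs))
  (trans (cong₂ _∪_ p (disjoint-⋃ ps)) (∪-idem ⊥))

-- Each member is disjoint from the union of the later ones, so the union is a sum over GF(2) and
-- closure under `⊕` suffices.
disjoint-⋃-closed : (P : Subset n → Set) → P ⊥ → (∀ {C R} → P C → P R → P (C ⊕ R)) →
  ∀ {Cs} → All P Cs → AllPairs (λ C C′ → C ∩ C′ ≡ ⊥) Cs → P (List.foldr _∪_ ⊥ Cs)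
disjoint-⋃-closed P P-⊥ P-⊕ []       []       = P-⊥
disjoint-⋃-closed P P-⊥ P-⊕ (p ∷ ps) (d ∷ ds) =
  subst P (sym (∩≡⊥⇒∪≡⊕ (disjoint-⋃ d))) (P-⊕ p (disjoint-⋃-closed P P-⊥ P-⊕ ps ds))

∈-⋃ : ∀ (Cs : List (Subset n)) → All (λ C → ∀ x → x ∈ C → x ∈ List.foldr _∪_ ⊥ Cs) Cs
∈-⋃ []       = []
∈-⋃ (C ∷ Cs) = (λ _ → p⊆p∪q _) ∷ All.map (λ h x x∈ → q⊆p∪q C _ (h x x∈)) (∈-⋃ Cs)

⊆∧⊈⇒⊂ : ∀ {S C : Subset n} → S ⊆ C → ¬ C ⊆ S → S ⊂ C
⊆∧⊈⇒⊂ {S = S} {C} S⊆C C⊈S with any? (λ x → x ∈? C ×-dec ¬? (x ∈? S))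
... | yes (x , x∈C , x∉S) = S⊆C , x , x∈C , x∉S
... | no none = contradiction (λ {x} x∈C → decidable-stable (x ∈? S) λ x∉S → none (x , x∈C , x∉S)) C⊈S

-- Parity of cardinalities

odd : ℕ → Bool
odd zero    = false
odd (suc n) = not (odd n)

%2≡odd : ∀ n → n % 2 ≡ (if odd n then 1 else 0)
%2≡odd zero          = refl
%2≡odd (suc zero)    = refl
%2≡odd (suc (suc n)) rewrite Bool.not-involutive (odd n) = %2≡odd n

odd-∣∣ : ∀ (X : Subset n) → odd ∣ X ∣ ≡ par X
odd-∣∣ []          = refl
odd-∣∣ (true ∷ X)  = cong not (odd-∣∣ X)
odd-∣∣ (false ∷ X) = odd-∣∣ X

∣∣%2 : ∀ (X : Subset n) → ∣ X ∣ % 2 ≡ (if par X then 1 else 0)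
∣∣%2 X = trans (%2≡odd ∣ X ∣) (cong (if_then 1 else 0) (odd-∣∣ X))

∣∣%2-injective : ∀ (X Y : Subset n) → ∣ X ∣ % 2 ≡ ∣ Y ∣ % 2 → par X ≡ par Y
∣∣%2-injective X Y eq with par X | par Y | trans (sym (∣∣%2 X)) (trans eq (∣∣%2 Y))
... | true  | true  | _ = refl
... | false | false | _ = refl

-- Injective self-maps of GF(2)^n are surjective

-- Numbering the bit vectors makes the pigeonhole principle on `Fin` available for them.
code : Vec Bool n → Fin (2 ^ n)
code []          = zero
code (false ∷ u) = combine {2} zero (code u)
code (true  ∷ u) = combine {2} (suc zero) (code u)

code-injective : ∀ (u w : Vec Bool n) → code u ≡ code w → u ≡ w
code-injective []          []          _  = refl
code-injective (false ∷ u) (false ∷ w) eq = cong (false ∷_) (code-injective u w (proj₂ (combine-injective {2} zero _ zero _ eq)))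
code-injective (false ∷ u) (true  ∷ w) eq with () ← proj₁ (combine-injective {2} zero (code u) (suc zero) _ eq)
code-injective (true  ∷ u) (false ∷ w) eq with () ← proj₁ (combine-injective {2} (suc zero) (code u) zero _ eq)
code-injective (true  ∷ u) (true  ∷ w) eq = cong (true ∷_) (code-injective u w (proj₂ (combine-injective {2} (suc zero) _ (suc zero) _ eq)))

-- If `z` were missed, punching it out would inject `Fin (suc N)` into `Fin N`.
Fin-injective⇒surjective : ∀ {N} (f : Fin N → Fin N) → (∀ {i j} → f i ≡ f j → i ≡ j) → ∀ z → ∃[ i ] f i ≡ z
Fin-injective⇒surjective {suc N} f inj z with any? (λ i → f i ≟ z)
... | yes hit = hit
... | no miss = contradiction (injective⇒≤ λ {i} {j} eq → inj (punchOut-injective (avoid i) (avoid j) eq)) 1+n≰n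
  where
  avoid : ∀ i → z ≢ f i
  avoid i eq = miss (i , sym eq)

code-surjective : ∀ (i : Fin (2 ^ n)) → ∃[ u ] code {n} u ≡ i
code-surjective {zero}  zero = [] , refl
code-surjective {suc n} i with combine-surjective {2} {2 ^ n} i
... | zero     , j , refl with u , eq ← code-surjective {n} j = false ∷ u , cong (combine {2} zero) eq
... | suc zero , j , refl with u , eq ← code-surjective {n} j = true ∷ u , cong (combine {2} (suc zero)) eq

decode : Fin (2 ^ n) → Vec Bool n
decode {n} i = proj₁ (code-surjective {n} i)

code-decode : ∀ (i : Fin (2 ^ n)) → code (decode {n} i) ≡ i
code-decode {n} i = proj₂ (code-surjective {n} i)

Vec-injective⇒surjective : (g : Vec Bool n → Vec Bool n) → (∀ {u w} → g u ≡ g w → u ≡ w) → ∀ z → ∃[ u ] g u ≡ z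
Vec-injective⇒surjective {n} g inj z
  with i , eq ← Fin-injective⇒surjective (code ∘ g ∘ decode {n})
                  (λ {i} {j} eq → trans (sym (code-decode {n} i)) (trans (cong code (inj (code-injective _ _ eq))) (code-decode {n} j)))
                  (code z)
  = decode {n} i , code-injective _ _ eq

-- Symmetric differences

△≡⊕ : ∀ (X Y : Subset n) → X △ Y ≡ X ⊕ Y
△≡⊕ []          []          = refl
△≡⊕ (true ∷ X)  (true ∷ Y)  = cong (false ∷_) (△≡⊕ X Y)
△≡⊕ (true ∷ X)  (false ∷ Y) = cong (true ∷_) (△≡⊕ X Y)
△≡⊕ (false ∷ X) (true ∷ Y)  = cong (true ∷_) (△≡⊕ X Y)
△≡⊕ (false ∷ X) (false ∷ Y) = cong (false ∷_) (△≡⊕ X Y)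

lookup-△ : ∀ (X Y : Subset n) i → lookup (X △ Y) i ≡ lookup X i xor lookup Y i
lookup-△ X Y i = trans (cong (λ Z → lookup Z i) (△≡⊕ X Y)) (lookup-⊕ X Y i)

∈-⊕⁻ : ∀ {X Y : Subset n} {i} → i ∈ X ⊕ Y → lookup X i xor lookup Y i ≡ true
∈-⊕⁻ {X = X} {Y} {i} i∈ = trans (sym (lookup-⊕ X Y i)) ([]=⇒lookup i∈)

xor-true : ∀ {a b} → a xor b ≡ true → a xor true ≡ b
xor-true {false} {true}  _ = refl
xor-true {true}  {false} _ = refl

≢⇒xor : ∀ {a b} → a ≢ b → a xor b ≡ true
≢⇒xor {false} {false} a≢b = contradiction refl a≢b
≢⇒xor {false} {true}  _   = refl
≢⇒xor {true}  {false} _   = refl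
≢⇒xor {true}  {true}  a≢b = contradiction refl a≢b

xor⇒≢ : ∀ {a b} → a xor b ≡ true → a ≢ b
xor⇒≢ {true} () refl

module Pair {x y : Fin n} where
  lookup-∪ : ∀ i → lookup (⁅ x ⁆ ∪ ⁅ y ⁆) i ≡ lookup ⁅ x ⁆ i ∨ lookup ⁅ y ⁆ i
  lookup-∪ i = lookup-zipWith _∨_ i ⁅ x ⁆ ⁅ y ⁆

  pair-left : lookup (⁅ x ⁆ ∪ ⁅ y ⁆) x ≡ true
  pair-left = trans (lookup-∪ x) (cong (_∨ lookup ⁅ y ⁆ x) (lookup-⁅⁆ x))

  pair-right : lookup (⁅ x ⁆ ∪ ⁅ y ⁆) y ≡ true
  pair-right = trans (lookup-∪ y) (trans (cong (lookup ⁅ x ⁆ y ∨_) (lookup-⁅⁆ y)) (Bool.∨-zeroʳ _))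

  pair-off : ∀ i → i ≢ x → i ≢ y → lookup (⁅ x ⁆ ∪ ⁅ y ⁆) i ≡ false
  pair-off i i≢x i≢y = trans (lookup-∪ i) (cong₂ _∨_ (lookup-⁅⁆-≢ i≢x) (lookup-⁅⁆-≢ i≢y))

  pair-⊕ : x ≢ y → ⁅ x ⁆ ∪ ⁅ y ⁆ ≡ ⁅ x ⁆ ⊕ ⁅ y ⁆
  pair-⊕ x≢y = vec-ext λ i → trans (lookup-∪ i) (trans (agree i) (sym (lookup-⊕ ⁅ x ⁆ ⁅ y ⁆ i)))
    where
    agree : ∀ i → lookup ⁅ x ⁆ i ∨ lookup ⁅ y ⁆ i ≡ lookup ⁅ x ⁆ i xor lookup ⁅ y ⁆ i
    agree i with i ≟ x
    ... | yes refl rewrite lookup-⁅⁆ x | lookup-⁅⁆-≢ x≢y = refl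
    ... | no i≢x rewrite lookup-⁅⁆-≢ i≢x = refl
open Pair

par-⁅⁆ : ∀ (x : Fin n) → par ⁅ x ⁆ ≡ true
par-⁅⁆ x = trans (par-single ⁅ x ⁆ x λ i → lookup-⁅⁆-≢) (lookup-⁅⁆ x)

par-flip : ∀ (X : Subset n) x → par (X ⊕ ⁅ x ⁆) ≢ par X
par-flip X x eq = contradiction (trans (sym (trans (par-⊕ X ⁅ x ⁆) (cong (par X xor_) (par-⁅⁆ x)))) eq) (flip-≢ (par X))
  where
  flip-≢ : ∀ b → b xor true ≢ b
  flip-≢ false ()
  flip-≢ true ()

par-△-pair : ∀ (X : Subset n) {x y} → x ≢ y → par (X △ (⁅ x ⁆ ∪ ⁅ y ⁆)) ≡ par X
par-△-pair X {x} {y} x≢y = begin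
  par (X △ (⁅ x ⁆ ∪ ⁅ y ⁆))        ≡⟨ cong par (△≡⊕ X _) ⟩
  par (X ⊕ (⁅ x ⁆ ∪ ⁅ y ⁆))        ≡⟨ cong (λ Z → par (X ⊕ Z)) (pair-⊕ x≢y) ⟩
  par (X ⊕ (⁅ x ⁆ ⊕ ⁅ y ⁆))        ≡⟨ par-⊕ X (⁅ x ⁆ ⊕ ⁅ y ⁆) ⟩
  par X xor par (⁅ x ⁆ ⊕ ⁅ y ⁆)    ≡⟨ cong (par X xor_) (trans (par-⊕ ⁅ x ⁆ ⁅ y ⁆) (cong₂ _xor_ (par-⁅⁆ x) (par-⁅⁆ y))) ⟩
  par X xor false                  ≡⟨ xor-identityʳ (par X) ⟩
  par X                            ∎
  where open ≡-Reasoning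

-- Counting members of a family modulo 2

-- The recursion splits on the first coordinate instead of running through a list, so that sums can
-- be evaluated coordinate by coordinate.
parity : (Subset n → Bool) → Bool
parity {zero}  g = g []
parity {suc n} g = parity (g ∘ (false ∷_)) xor parity (g ∘ (true ∷_))

parity-cong : ∀ {g h : Subset n → Bool} → (∀ W → g W ≡ h W) → parity g ≡ parity h
parity-cong {zero}  eq = eq []
parity-cong {suc n} eq = cong₂ _xor_ (parity-cong (eq ∘ (false ∷_))) (parity-cong (eq ∘ (true ∷_)))

parity-false : ∀ n → parity {n} (λ _ → false) ≡ false
parity-false zero    = refl
parity-false (suc n) rewrite parity-false n = refl

odd-+ : ∀ a b → odd (a + b) ≡ odd a xor odd b
odd-+ zero    b = refl
odd-+ (suc a) b = trans (cong not (odd-+ a b)) (Bool.not-distribˡ-xor (odd a) (odd b))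

length-filterᵇ-map : ∀ {A B : Set} (g : B → Bool) (f : A → B) xs → length (filterᵇ g (List.map f xs)) ≡ length (filterᵇ (g ∘ f) xs)
length-filterᵇ-map g f []       = refl
length-filterᵇ-map g f (x ∷ xs) with g (f x)
... | true  = cong suc (length-filterᵇ-map g f xs)
... | false = length-filterᵇ-map g f xs

length-filterᵇ-++ : ∀ {A : Set} (g : A → Bool) xs ys → length (filterᵇ g (xs ++ ys)) ≡ length (filterᵇ g xs) + length (filterᵇ g ys)
length-filterᵇ-++ g []       ys = refl
length-filterᵇ-++ g (x ∷ xs) ys with g x
... | true  = cong suc (length-filterᵇ-++ g xs ys)
... | false = length-filterᵇ-++ g xs ys

odd-count : ∀ (g : Subset n → Bool) → odd (length (filterᵇ g (allSubsets n))) ≡ parity g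
odd-count {zero} g with g []
... | true  = refl
... | false = refl
odd-count {suc n} g = begin
  odd (length (filterᵇ g (out ++ inn)))                       ≡⟨ cong odd (length-filterᵇ-++ g out inn) ⟩
  odd (length (filterᵇ g out) + length (filterᵇ g inn))       ≡⟨ odd-+ (length (filterᵇ g out)) _ ⟩
  odd (length (filterᵇ g out)) xor odd (length (filterᵇ g inn))
    ≡⟨ cong₂ _xor_ (cong odd (length-filterᵇ-map g (false ∷_) (allSubsets n))) (cong odd (length-filterᵇ-map g (true ∷_) (allSubsets n))) ⟩
  odd (length (filterᵇ (g ∘ (false ∷_)) (allSubsets n))) xor odd (length (filterᵇ (g ∘ (true ∷_)) (allSubsets n)))
    ≡⟨ cong₂ _xor_ (odd-count (g ∘ (false ∷_))) (odd-count (g ∘ (true ∷_))) ⟩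
  parity g                                                    ∎
  where
  open ≡-Reasoning
  out inn : List (Subset (suc n))
  out = List.map (false ∷_) (allSubsets n)
  inn = List.map (true ∷_) (allSubsets n)

count≡parity : ∀ (g : Subset n → Bool) → (length (filterᵇ g (allSubsets n)) % 2 ≡ᵇ 1) ≡ parity g
count≡parity {n} g = trans (isOdd (length (filterᵇ g (allSubsets n)))) (odd-count g)
  where
  isOdd : ∀ l → (l % 2 ≡ᵇ 1) ≡ odd l
  isOdd l rewrite %2≡odd l with odd l
  ... | true  = refl
  ... | false = refl

isYes-true : ∀ {A : Set} (a? : Dec A) → A → isYes a? ≡ true
isYes-true (yes _) _ = refl
isYes-true (no ¬a) a = contradiction a ¬a

-- The lower bound `Y ─ ⊤` is empty, so only the condition `W ⊆ Y` remains.
+ₗ⊤≡parity : ∀ (D : SetSystem n) Y → (D +ₗ ⊤) Y ≡ parity (λ W → does (W ⊆? Y) ∧ D W)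
+ₗ⊤≡parity D Y = trans (count≡parity (λ W → isYes ((Y ─ ⊤) ⊆? W) ∧ isYes (W ⊆? Y) ∧ D W)) (parity-cong λ W →
  cong₂ _∧_ (isYes-true ((Y ─ ⊤) ⊆? W) λ {x} x∈ → contradiction ∈⊤ (x∈p∧x∉q x∈)) (cong (_∧ D W) (isYes≗does (W ⊆? Y))))
  where
  x∈p∧x∉q : ∀ {n} {Y : Subset n} {x} → x ∈ Y ─ ⊤ → x ∉ ⊤
  x∈p∧x∉q {Y = _ ∷ Y} (there x∈) (there x∈⊤) = x∈p∧x∉q x∈ x∈⊤

-- The upper bound `Y ∪ ⊤` is everything, so only the condition `Y ⊆ W` remains.
*̄⊤≡parity : ∀ (D : SetSystem n) Y → (D *̄ ⊤) Y ≡ parity (λ W → does (Y ⊆? W) ∧ D W)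
*̄⊤≡parity D Y = trans (count≡parity (λ W → isYes (Y ⊆? W) ∧ isYes (W ⊆? (Y ∪ ⊤)) ∧ D W)) (parity-cong λ W →
  cong₂ _∧_ (isYes≗does (Y ⊆? W)) (cong (_∧ D W) (isYes-true (W ⊆? (Y ∪ ⊤)) λ _ → q⊆p∪q Y ⊤ ∈⊤)))

-- Lagrangian subspaces of GF(2)^n × GF(2)^n of product form

-- A pair (v, k) is read coordinatewise as an element of GF(2)², whose three nonzero elements are (1,0), (0,1) and (1,1).
data Ty : Set where
  ⟨10⟩ ⟨01⟩ ⟨11⟩ : Ty

-- The linear functional on GF(2)² whose kernel is spanned by t.
off : Ty → Bool → Bool → Bool
off ⟨10⟩ v k = k
off ⟨01⟩ v k = v
off ⟨11⟩ v k = v xor k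

-- Over GF(2) this is symmetric in the three letters: their values add up to 0.
ThreeTerm : (Vec Ty n → Bool) → Set
ThreeTerm f = ∀ ts i → f (ts [ i ]≔ ⟨10⟩) xor f (ts [ i ]≔ ⟨01⟩) ≡ f (ts [ i ]≔ ⟨11⟩)

letters : Ty → Ty → Subset n → Vec Ty n
letters p q = Vec.map (if_then p else q)

lookup-letters : ∀ p q (Y : Subset n) i → lookup (letters p q Y) i ≡ (if lookup Y i then p else q)
lookup-letters p q Y i = lookup-map i (if_then p else q) Y

-- A coordinate outside `Y` is forced to the letter ⟨10⟩. A coordinate in `Y` is summed over ⟨10⟩
-- and ⟨01⟩, which the three-term relation replaces by ⟨11⟩.
parity-below : ∀ (f : Vec Ty n → Bool) → ThreeTerm f → ∀ Y →
  parity (λ W → does (W ⊆? Y) ∧ f (letters ⟨01⟩ ⟨10⟩ W)) ≡ f (letters ⟨11⟩ ⟨10⟩ Y)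
parity-below f f3 [] = refl
parity-below {suc n} f f3 (false ∷ Y) = trans
  (cong₂ _xor_ (parity-below (f ∘ (⟨10⟩ ∷_)) (λ ts i → f3 (⟨10⟩ ∷ ts) (suc i)) Y) (parity-false n))
  (xor-identityʳ _)
parity-below f f3 (true ∷ Y) = trans
  (cong₂ _xor_ (parity-below (f ∘ (⟨10⟩ ∷_)) (λ ts i → f3 (⟨10⟩ ∷ ts) (suc i)) Y)
               (parity-below (f ∘ (⟨01⟩ ∷_)) (λ ts i → f3 (⟨01⟩ ∷ ts) (suc i)) Y))
  (f3 (⟨10⟩ ∷ letters ⟨11⟩ ⟨10⟩ Y) zero)

-- Now the coordinates in `Y` are forced to ⟨01⟩, and those outside are summed over both letters and
-- become ⟨11⟩.
parity-above : ∀ (f : Vec Ty n → Bool) → ThreeTerm f → ∀ Y →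
  parity (λ W → does (Y ⊆? W) ∧ f (letters ⟨01⟩ ⟨10⟩ W)) ≡ f (letters ⟨01⟩ ⟨11⟩ Y)
parity-above f f3 [] = refl
parity-above f f3 (false ∷ Y) = trans
  (cong₂ _xor_ (parity-above (f ∘ (⟨10⟩ ∷_)) (λ ts i → f3 (⟨10⟩ ∷ ts) (suc i)) Y)
               (parity-above (f ∘ (⟨01⟩ ∷_)) (λ ts i → f3 (⟨01⟩ ∷ ts) (suc i)) Y))
  (f3 (⟨10⟩ ∷ letters ⟨01⟩ ⟨11⟩ Y) zero)
parity-above {suc n} f f3 (true ∷ Y) =
  cong₂ _xor_ (parity-false n) (parity-above (f ∘ (⟨01⟩ ∷_)) (λ ts i → f3 (⟨01⟩ ∷ ts) (suc i)) Y)

-- The symplectic form of GF(2)², that is, the determinant of the two vectors.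
form : Bool → Bool → Bool → Bool → Bool
form v k v′ k′ = (v ∧ k′) xor (v′ ∧ k)

off-xor : ∀ t v k v′ k′ → off t (v xor v′) (k xor k′) ≡ off t v k xor off t v′ k′
off-xor ⟨10⟩ v k v′ k′ = refl
off-xor ⟨01⟩ v k v′ k′ = refl
off-xor ⟨11⟩ v k v′ k′ = xor-interchange v v′ k k′

off-zero : ∀ t → off t false false ≡ false
off-zero ⟨10⟩ = refl
off-zero ⟨01⟩ = refl
off-zero ⟨11⟩ = refl

form-same : ∀ t v k v′ k′ → off t v k ≡ false → off t v′ k′ ≡ false → form v k v′ k′ ≡ false
form-same ⟨10⟩ false false false false _ _ = refl
form-same ⟨10⟩ false false true  false _ _ = refl
form-same ⟨10⟩ true  false false false _ _ = refl
form-same ⟨10⟩ true  false true  false _ _ = refl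
form-same ⟨01⟩ false k     false k′    _ _ = refl
form-same ⟨11⟩ false false false false _ _ = refl
form-same ⟨11⟩ false false true  true  _ _ = refl
form-same ⟨11⟩ true  true  false false _ _ = refl
form-same ⟨11⟩ true  true  true  true  _ _ = refl

-- In the plane only multiples of `(v, k)` are orthogonal to it, and its line meets the line of `t`
-- only in 0.
form-nondegenerate : ∀ t v k v′ k′ → off t v k ≡ true → off t v′ k′ ≡ false → form v k v′ k′ ≡ false →
  v′ ≡ false × k′ ≡ false
form-nondegenerate t    _     _     false false _ _ _ = refl , refl
form-nondegenerate ⟨10⟩ false true  true  false _ _ ()
form-nondegenerate ⟨10⟩ true  true  true  false _ _ ()
form-nondegenerate ⟨01⟩ true  false false true  _ _ ()
form-nondegenerate ⟨01⟩ true  true  false true  _ _ ()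
form-nondegenerate ⟨11⟩ false true  true  true  _ _ ()
form-nondegenerate ⟨11⟩ true  false true  true  _ _ ()

-- A vector off two of the lines is nonzero, and GF(2)² has only three lines.
off-third : ∀ p q r v k → p ≢ q → r ≢ p → r ≢ q → off p v k ≡ true → off q v k ≡ true → off r v k ≡ false
off-third ⟨10⟩ ⟨10⟩ r    v    k    p≢q _   _   _ _ = contradiction refl p≢q
off-third ⟨01⟩ ⟨01⟩ r    v    k    p≢q _   _   _ _ = contradiction refl p≢q
off-third ⟨11⟩ ⟨11⟩ r    v    k    p≢q _   _   _ _ = contradiction refl p≢q
off-third ⟨10⟩ q    ⟨10⟩ v    k    _   r≢p _   _ _ = contradiction refl r≢p
off-third ⟨01⟩ q    ⟨01⟩ v    k    _   r≢p _   _ _ = contradiction refl r≢p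
off-third ⟨11⟩ q    ⟨11⟩ v    k    _   r≢p _   _ _ = contradiction refl r≢p
off-third p    ⟨10⟩ ⟨10⟩ v    k    _   _   r≢q _ _ = contradiction refl r≢q
off-third p    ⟨01⟩ ⟨01⟩ v    k    _   _   r≢q _ _ = contradiction refl r≢q
off-third p    ⟨11⟩ ⟨11⟩ v    k    _   _   r≢q _ _ = contradiction refl r≢q
off-third ⟨10⟩ ⟨01⟩ ⟨11⟩ true true _   _   _   _ _ = refl
off-third ⟨01⟩ ⟨10⟩ ⟨11⟩ true true _   _   _   _ _ = refl
off-third ⟨10⟩ ⟨11⟩ ⟨01⟩ false true _  _   _   _ _ = refl
off-third ⟨11⟩ ⟨10⟩ ⟨01⟩ false true _  _   _   _ _ = refl
off-third ⟨01⟩ ⟨11⟩ ⟨10⟩ true false _  _   _   _ _ = refl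
off-third ⟨11⟩ ⟨01⟩ ⟨10⟩ true false _  _   _   _ _ = refl

off-both : ∀ p q v k → p ≢ q → off p v k ≡ false → off q v k ≡ false → v ≡ false × k ≡ false
off-both p    q    false false _   _ _ = refl , refl
off-both ⟨10⟩ ⟨10⟩ true  false p≢q _ _ = contradiction refl p≢q
off-both ⟨01⟩ ⟨01⟩ false true  p≢q _ _ = contradiction refl p≢q
off-both ⟨11⟩ ⟨11⟩ true  true  p≢q _ _ = contradiction refl p≢q

-- φ and ψ embed GF(2)^n into L × K, which makes this isotropic subspace maximal.
record Lagrangian (n : ℕ) : Set₁ where
  field
    L K   : Subset n → Set
    L?    : ∀ v → Dec (L v)
    K?    : ∀ k → Dec (K k)
    L-⊕   : ∀ {v v′} → L v → L v′ → L (v ⊕ v′)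
    K-⊕   : ∀ {k k′} → K k → K k′ → K (k ⊕ k′)
    L⊥K   : ∀ {v k} → L v → K k → dot v k ≡ false
    φ ψ   : Subset n → Subset n
    φ∈L   : ∀ u → L (φ u)
    ψ∈K   : ∀ u → K (ψ u)
    φψ-injective : ∀ {u w} → φ u ≡ φ w → ψ u ≡ ψ w → u ≡ w

-- Transversals whose span meets L × K trivially

module Transversals (Λ : Lagrangian n) where
  open Lagrangian Λ

  -- Marks the coordinates at which `(v, k)` leaves the line of `t`.
  dev : (Fin n → Ty) → Subset n → Subset n → Fin n → Bool
  dev t v k i = off (t i) (lookup v i) (lookup k i)

  record InSpan (t : Fin n → Ty) (v k : Subset n) : Set where
    constructor inSpan
    field at : ∀ i → dev t v k i ≡ false
  open InSpan

  Trivial : (Fin n → Ty) → Set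
  Trivial t = ∀ v k → L v → K k → InSpan t v k → v ≡ ⊥ × k ≡ ⊥

  Witness : (Fin n → Ty) → Subset n → Subset n → Set
  Witness t v k = L v × K k × InSpan t v k × ¬ (v ≡ ⊥ × k ≡ ⊥)

  witness? : ∀ t → Dec (∃₂ (Witness t))
  witness? t = anySubset? λ v → anySubset? λ k →
    L? v ×-dec K? k ×-dec map′ inSpan at (all? (λ i → dev t v k i Bool.≟ false)) ×-dec
    ¬? (≡-dec Bool._≟_ v ⊥ ×-dec ≡-dec Bool._≟_ k ⊥)

  no-witness⇒trivial : ∀ {t} → ¬ ∃₂ (Witness t) → Trivial t
  no-witness⇒trivial none v k v∈L k∈K in-t =
    decidable-stable (≡-dec Bool._≟_ v ⊥ ×-dec ≡-dec Bool._≟_ k ⊥) λ nz → none (v , k , v∈L , k∈K , in-t , nz)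

  trivial? : ∀ t → Dec (Trivial t)
  trivial? t with witness? t
  ... | yes (v , k , v∈L , k∈K , in-t , nz) = no λ triv → nz (triv v k v∈L k∈K in-t)
  ... | no none = yes (no-witness⇒trivial none)

  nontrivial⇒witness : ∀ {t} → ¬ Trivial t → ∃₂ (Witness t)
  nontrivial⇒witness {t} ¬triv = decidable-stable (witness? t) (¬triv ∘ no-witness⇒trivial)

  dev-⊕ : ∀ t v k v′ k′ i → dev t (v ⊕ v′) (k ⊕ k′) i ≡ dev t v k i xor dev t v′ k′ i
  dev-⊕ t v k v′ k′ i = trans (cong₂ (off (t i)) (lookup-⊕ v v′ i) (lookup-⊕ k k′ i))
    (off-xor (t i) (lookup v i) (lookup k i) (lookup v′ i) (lookup k′ i))

  off-cong : ∀ {p q} v k (i : Fin n) → p ≡ q → off p (lookup v i) (lookup k i) ≡ off q (lookup v i) (lookup k i)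
  off-cong v k i eq = cong (λ u → off u (lookup v i) (lookup k i)) eq

  dev-zero : ∀ t v k i → lookup v i ≡ false → lookup k i ≡ false → dev t v k i ≡ false
  dev-zero t v k i p q = trans (cong₂ (off (t i)) p q) (off-zero (t i))

  dev-⊥ : ∀ t {v k} i → v ≡ ⊥ × k ≡ ⊥ → dev t v k i ≡ false
  dev-⊥ t i (refl , refl) = dev-zero t ⊥ ⊥ i (lookup-⊥ i) (lookup-⊥ i)

  AgreeOff : Fin n → (Fin n → Ty) → (Fin n → Ty) → Set
  AgreeOff x t s = ∀ i → i ≢ x → t i ≡ s i

  inSpan-off : ∀ {t r v k} x → AgreeOff x t r → (∀ i → i ≢ x → dev t v k i ≡ false) → dev r v k x ≡ false → InSpan r v k
  inSpan-off {t} {r} {v} {k} x t~r in-t at-x = inSpan in-r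
    where
    in-r : ∀ i → dev r v k i ≡ false
    in-r i with i ≟ x
    ... | yes refl = at-x
    ... | no i≢x  = trans (off-cong v k i (sym (t~r i i≢x))) (in-t i i≢x)

  Trivial-cong : ∀ {t s} → (∀ i → t i ≡ s i) → Trivial t → Trivial s
  Trivial-cong eq triv v k v∈L k∈K in-s = triv v k v∈L k∈K (inSpan λ i → trans (off-cong v k i (eq i)) (at in-s i))

  -- The coordinatewise forms add up to the symplectic product, which is 0 on L × K; if all but one
  -- vanish, so does the last.
  isotropic : ∀ v k v′ k′ → L v → K k → L v′ → K k′ → ∀ y →
    (∀ i → i ≢ y → form (lookup v i) (lookup k i) (lookup v′ i) (lookup k′ i) ≡ false) →
    form (lookup v y) (lookup k y) (lookup v′ y) (lookup k′ y) ≡ false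
  isotropic v k v′ k′ v∈L k∈K v′∈L k′∈K y h = begin
    form (lookup v y) (lookup k y) (lookup v′ y) (lookup k′ y) ≡⟨ lookup-z y ⟨
    lookup z y                                                ≡⟨ par-single z y (λ i i≢y → trans (lookup-z i) (h i i≢y)) ⟨
    par z                                                     ≡⟨ par-⊕ (v ∩ k′) (v′ ∩ k) ⟩
    dot v k′ xor dot v′ k                                     ≡⟨ cong₂ _xor_ (L⊥K v∈L k′∈K) (L⊥K v′∈L k∈K) ⟩
    false                                                     ∎
    where
    open ≡-Reasoning
    z : Subset n
    z = (v ∩ k′) ⊕ (v′ ∩ k)
    lookup-z : ∀ i → lookup z i ≡ form (lookup v i) (lookup k i) (lookup v′ i) (lookup k′ i)
    lookup-z i = trans (lookup-⊕ (v ∩ k′) (v′ ∩ k) i) (cong₂ _xor_ (lookup-zipWith _∧_ i v k′) (lookup-zipWith _∧_ i v′ k))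

  -- If L × K meets span t trivially, it is a complement of span t, so every deviation pattern occurs.
  complement : ∀ t → Trivial t → ∀ z → ∃₂ λ v k → L v × K k × (∀ i → dev t v k i ≡ lookup z i)
  complement t triv z = φ u , ψ u , φ∈L u , ψ∈K u , λ i → trans (sym (lookup∘tabulate _ i)) (cong (λ z → lookup z i) (proj₂ preimage))
    where
    g : Subset n → Subset n
    g u = tabulate (dev t (φ u) (ψ u))
    -- Elements with equal deviation patterns differ by an element of span `t`, hence are equal. So
    -- `g` is an injective self-map of a finite set, and therefore onto.
    g-injective : ∀ {u w} → g u ≡ g w → u ≡ w
    g-injective {u} {w} eq = φψ-injective (⊕≡⊥⇒≡ (proj₁ zeros)) (⊕≡⊥⇒≡ (proj₂ zeros))
      where
      same : ∀ i → dev t (φ u) (ψ u) i ≡ dev t (φ w) (ψ w) i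
      same i = trans (sym (lookup∘tabulate _ i)) (trans (cong (λ z → lookup z i) eq) (lookup∘tabulate _ i))
      zeros : φ u ⊕ φ w ≡ ⊥ × ψ u ⊕ ψ w ≡ ⊥
      zeros = triv _ _ (L-⊕ (φ∈L u) (φ∈L w)) (K-⊕ (ψ∈K u) (ψ∈K w)) (inSpan λ i →
        trans (dev-⊕ t (φ u) (ψ u) (φ w) (ψ w) i) (trans (cong (_xor dev t (φ w) (ψ w) i) (same i)) (xor-same (dev t (φ w) (ψ w) i))))
    preimage : ∃[ u ] g u ≡ z
    preimage = Vec-injective⇒surjective g g-injective z
    u : Subset n
    u = proj₁ preimage

  -- This generalises the fundamental circuits and cocircuits of a basis.
  complement-at : ∀ t → Trivial t → ∀ j →
    ∃₂ λ v k → L v × K k × dev t v k j ≡ true × (∀ i → i ≢ j → dev t v k i ≡ false)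
  complement-at t triv j with v , k , v∈L , k∈K , h ← complement t triv ⁅ j ⁆ =
    v , k , v∈L , k∈K , trans (h j) (lookup-⁅⁆ j) , λ i i≢j → trans (h i) (lookup-⁅⁆-≢ i≢j)

  -- An element of L × K leaving `t` only at `x` must leave `s` there too, so at `x` it lies on the
  -- third line. It is then a nonzero element of span `r`.
  trivial-third : ∀ {t s r} x → AgreeOff x t s → AgreeOff x t r → t x ≢ s x → r x ≢ t x → r x ≢ s x →
    Trivial t → Trivial s → ¬ Trivial r
  trivial-third {t} {s} {r} x t~s t~r t≢s r≢t r≢s triv-t triv-s triv-r
    with v , k , v∈L , k∈K , at-x , off-x ← complement-at t triv-t x
    = contradiction (trans (sym at-x) (dev-⊥ t x (triv-r v k v∈L k∈K in-r))) λ ()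
    where
    at-x-s : dev s v k x ≡ true
    at-x-s = ¬-not λ eq → contradiction
      (trans (sym at-x) (dev-⊥ t x (triv-s v k v∈L k∈K (inSpan-off x t~s off-x eq)))) λ ()
    in-r : InSpan r v k
    in-r = inSpan-off x t~r off-x (off-third (t x) (s x) (r x) (lookup v x) (lookup k x) t≢s r≢t r≢s at-x at-x-s)

  -- Take nonzero elements of L × K in span `t` and in span `s`. Their forms vanish away from `x`,
  -- hence by isotropy also at `x`, where their lines differ. So one of the two is 0 at `x` and lies
  -- in span `r`.
  nontrivial-third : ∀ {t s r} x → AgreeOff x t s → AgreeOff x t r → t x ≢ s x →
    ¬ Trivial t → ¬ Trivial s → ¬ Trivial r
  nontrivial-third {t} {s} {r} x t~s t~r t≢s ¬t ¬s triv-r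
    with v , k , v∈L , k∈K , in-t , nz ← nontrivial⇒witness ¬t
       | v′ , k′ , v′∈L , k′∈K , in-s , nz′ ← nontrivial⇒witness ¬s
    with dev s v k x in eq
  ... | false with p , q ← off-both (t x) (s x) (lookup v x) (lookup k x) t≢s (at in-t x) eq
      = nz (triv-r v k v∈L k∈K (inSpan-off x t~r (λ i _ → at in-t i) (dev-zero r v k x p q)))
  ... | true  = nz′ (triv-r v′ k′ v′∈L k′∈K (inSpan-off x s~r (λ i _ → at in-s i) (dev-zero r v′ k′ x (proj₁ zeros) (proj₂ zeros))))
    where
    s~r : AgreeOff x s r
    s~r i i≢x = trans (sym (t~s i i≢x)) (t~r i i≢x)
    zeros : lookup v′ x ≡ false × lookup k′ x ≡ false
    zeros = form-nondegenerate (s x) (lookup v x) (lookup k x) (lookup v′ x) (lookup k′ x) eq (at in-s x)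
      (isotropic v k v′ k′ v∈L k∈K v′∈L k′∈K x λ i i≢x →
        form-same (t i) (lookup v i) (lookup k i) (lookup v′ i) (lookup k′ i) (at in-t i) (trans (off-cong v′ k′ i (t~s i i≢x)) (at in-s i)))

  -- If changing `t` at `x` alone preserves triviality, `y = x` works. Otherwise the changed
  -- transversal spans a nonzero element of L × K; it cannot lie in span `s`, and any `y` where it
  -- leaves `s` works. Describing `r` by its values allows any pointwise equal encoding of the
  -- result.
  exchange : ∀ t s → Trivial t → Trivial s → ∀ x → t x ≢ s x →
    ∃[ y ] t y ≢ s y × (∀ r → r x ≡ s x → r y ≡ s y → (∀ i → i ≢ x → i ≢ y → r i ≡ t i) → Trivial r)
  exchange t s triv-t triv-s x t≢s with trivial? (updateAt t x (const (s x)))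
  ... | yes triv = x , t≢s , λ r rx _ r~t → Trivial-cong (agree r rx r~t) triv
    where
    agree : ∀ r → r x ≡ s x → (∀ i → i ≢ x → i ≢ x → r i ≡ t i) → ∀ i → updateAt t x (const (s x)) i ≡ r i
    agree r rx r~t i with i ≟ x
    ... | yes refl = trans (updateAt-updates x t) (sym rx)
    ... | no i≢x  = trans (updateAt-minimal i x t i≢x) (sym (r~t i i≢x i≢x))
  ... | no ¬triv with v , k , v∈L , k∈K , in-t′ , nz ← nontrivial⇒witness ¬triv
    = y , t≢s-at-y , trivial
    where
    t′ : Fin n → Ty
    t′ = updateAt t x (const (s x))
    t′x : t′ x ≡ s x
    t′x = updateAt-updates x t
    t′~t : AgreeOff x t′ t
    t′~t i i≢x = updateAt-minimal i x t i≢x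
    at-x : dev t v k x ≡ true
    at-x = ¬-not λ eq → nz (triv-t v k v∈L k∈K (inSpan-off x t′~t (λ i _ → at in-t′ i) eq))
    leaves-s : ∃[ y ] dev s v k y ≡ true
    leaves-s with any? (λ y → dev s v k y Bool.≟ true)
    ... | yes hit = hit
    ... | no none = contradiction (triv-s v k v∈L k∈K (inSpan λ i → ¬-not λ eq → none (i , eq))) nz
    y : Fin n
    y = proj₁ leaves-s
    at-y : dev s v k y ≡ true
    at-y = proj₂ leaves-s
    y≢x : y ≢ x
    y≢x eq = contradiction (trans (sym at-y) (trans (off-cong v k y (trans (cong s eq) (trans (sym t′x) (cong t′ (sym eq))))) (at in-t′ y))) λ ()
    t≢s-at-y : t y ≢ s y
    t≢s-at-y eq = contradiction (trans (sym at-y) (trans (off-cong v k y (trans (sym eq) (sym (t′~t y y≢x)))) (at in-t′ y))) λ ()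
    trivial : ∀ r → r x ≡ s x → r y ≡ s y → (∀ i → i ≢ x → i ≢ y → r i ≡ t i) → Trivial r
    trivial r rx ry r~t v′ k′ v′∈L k′∈K in-r = conclude
      where
      r~t′ : AgreeOff y r t′
      r~t′ i i≢y with i ≟ x
      ... | yes refl = trans rx (sym t′x)
      ... | no i≢x  = trans (r~t i i≢x i≢y) (sym (t′~t i i≢x))
      -- Away from `y` both elements lie on the lines of `t′`, so isotropy leaves only the form at
      -- `y`; there `(v, k)` is off the line of `s`.
      zero-y : lookup v′ y ≡ false × lookup k′ y ≡ false
      zero-y = form-nondegenerate (s y) (lookup v y) (lookup k y) (lookup v′ y) (lookup k′ y) at-y
        (trans (off-cong v′ k′ y (sym ry)) (at in-r y))
        (isotropic v k v′ k′ v∈L k∈K v′∈L k′∈K y λ i i≢y →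
          form-same (t′ i) (lookup v i) (lookup k i) (lookup v′ i) (lookup k′ i) (at in-t′ i)
            (trans (off-cong v′ k′ i (sym (r~t′ i i≢y))) (at in-r i)))
      in-t′′ : InSpan t′ v′ k′
      in-t′′ = inSpan-off y r~t′ (λ i _ → at in-r i) (dev-zero t′ v′ k′ y (proj₁ zero-y) (proj₂ zero-y))
      -- Both elements now lie in span `t′`. If `(v′, k′)` leaves `t` at `x`, as `(v, k)` does,
      -- their sum is in span `t` and hence 0; but they differ at `y`.
      conclude : v′ ≡ ⊥ × k′ ≡ ⊥
      conclude with dev t v′ k′ x in eq
      ... | false = triv-t v′ k′ v′∈L k′∈K (inSpan-off x t′~t (λ i _ → at in-t′′ i) eq)
      ... | true  = contradiction (trans (sym at-y) (dev-zero s v k y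
                      (trans (cong (λ z → lookup z y) (⊕≡⊥⇒≡ (proj₁ sum-zero))) (proj₁ zero-y))
                      (trans (cong (λ z → lookup z y) (⊕≡⊥⇒≡ (proj₂ sum-zero))) (proj₂ zero-y)))) λ ()
        where
        sum-zero : v ⊕ v′ ≡ ⊥ × k ⊕ k′ ≡ ⊥
        sum-zero = triv-t _ _ (L-⊕ v∈L v′∈L) (K-⊕ k∈K k′∈K) (inSpan-off x t′~t
          (λ i _ → trans (dev-⊕ t′ v k v′ k′ i) (cong₂ _xor_ (at in-t′ i) (at in-t′′ i)))
          (trans (dev-⊕ t v k v′ k′ x) (cong₂ _xor_ at-x eq)))

  indicator : Vec Ty n → Bool
  indicator ts = does (trivial? (lookup ts))

  indicator⇔ : ∀ ts → indicator ts ≡ true ⇔ Trivial (lookup ts)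
  indicator⇔ ts with trivial? (lookup ts)
  ... | yes triv = mk⇔ (λ _ → triv) (λ _ → refl)
  ... | no ¬triv = mk⇔ (λ ()) (λ triv → contradiction triv ¬triv)

  updates-agree : ∀ ts i p q → AgreeOff i (lookup (ts [ i ]≔ p)) (lookup (ts [ i ]≔ q))
  updates-agree ts i p q j j≢i = trans (lookup∘updateAt′ j i j≢i ts) (sym (lookup∘updateAt′ j i j≢i ts))

  updates-differ : ∀ (ts : Vec Ty n) i {p q} → p ≢ q → lookup (ts [ i ]≔ p) i ≢ lookup (ts [ i ]≔ q) i
  updates-differ ts i p≢q eq = p≢q (trans (sym (lookup∘updateAt i ts)) (trans eq (lookup∘updateAt i ts)))

  -- The number of trivial transversals among the three is even: `trivial-third` excludes three, and
  -- `nontrivial-third` excludes exactly one.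
  indicator-threeTerm : ThreeTerm indicator
  indicator-threeTerm ts i
    with trivial? (lookup (ts [ i ]≔ ⟨10⟩)) | trivial? (lookup (ts [ i ]≔ ⟨01⟩)) | trivial? (lookup (ts [ i ]≔ ⟨11⟩))
  ... | yes A | yes B | no ¬C = refl
  ... | yes A | no ¬B | yes C = refl
  ... | no ¬A | yes B | yes C = refl
  ... | no ¬A | no ¬B | no ¬C = refl
  ... | yes A | yes B | yes C = contradiction C
    (trivial-third i (updates-agree ts i ⟨10⟩ ⟨01⟩) (updates-agree ts i ⟨10⟩ ⟨11⟩) (updates-differ ts i λ ()) (updates-differ ts i λ ()) (updates-differ ts i λ ()) A B)
  ... | yes A | no ¬B | no ¬C = contradiction A
    (nontrivial-third i (updates-agree ts i ⟨01⟩ ⟨11⟩) (updates-agree ts i ⟨01⟩ ⟨10⟩) (updates-differ ts i λ ()) ¬B ¬C)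
  ... | no ¬A | yes B | no ¬C = contradiction B
    (nontrivial-third i (updates-agree ts i ⟨10⟩ ⟨11⟩) (updates-agree ts i ⟨10⟩ ⟨01⟩) (updates-differ ts i λ ()) ¬A ¬C)
  ... | no ¬A | no ¬B | yes C = contradiction C
    (nontrivial-third i (updates-agree ts i ⟨10⟩ ⟨01⟩) (updates-agree ts i ⟨10⟩ ⟨11⟩) (updates-differ ts i λ ()) ¬A ¬B)

  -- Exchange and parity for families of two-letter transversals

  enc : Ty → Ty → Subset n → Fin n → Ty
  enc p q Y i = if lookup Y i then p else q

  module TwoLetters {p q : Ty} (p≢q : p ≢ q) (D : SetSystem n) (D⇔ : ∀ Y → Y ∈ₛ D ⇔ Trivial (enc p q Y)) where

    ρ : Bool → Bool → Bool
    ρ v k = off p v k ∧ off q v k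

    trivial-∈ : ∀ {Y} → Y ∈ₛ D → Trivial (enc p q Y)
    trivial-∈ {Y} = Equivalence.to (D⇔ Y)

    enc-cong : ∀ X Y i → lookup X i ≡ lookup Y i → enc p q X i ≡ enc p q Y i
    enc-cong X Y i = cong (if_then p else q)

    enc-injective : ∀ X Y i → enc p q X i ≡ enc p q Y i → lookup X i ≡ lookup Y i
    enc-injective X Y i eq with lookup X i | lookup Y i
    ... | true  | true  = refl
    ... | false | false = refl
    ... | true  | false = contradiction eq p≢q
    ... | false | true  = contradiction (sym eq) p≢q

    -- Toggling `x` and `y` in `X` gives the transversal that follows `Y` at these two elements and
    -- `X` elsewhere, as `exchange` demands.
    Δ-exchange : ∀ X Y x → X ∈ₛ D → Y ∈ₛ D → x ∈ (X △ Y) → ∃[ y ] (y ∈ (X △ Y) × (X △ (⁅ x ⁆ ∪ ⁅ y ⁆)) ∈ₛ D)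
    Δ-exchange X Y x X∈D Y∈D x∈ = conclude
      where
      flipped : ∀ {i} → lookup X i xor lookup Y i ≡ true → ∀ S → lookup S i ≡ true → enc p q (X △ S) i ≡ enc p q Y i
      flipped {i} ne S eq = enc-cong (X △ S) Y i (trans (lookup-△ X S i) (trans (cong (lookup X i xor_) eq) (xor-true {lookup X i} ne)))
      xor-x : lookup X x xor lookup Y x ≡ true
      xor-x = trans (sym (lookup-△ X Y x)) ([]=⇒lookup x∈)
      conclude : ∃[ y ] (y ∈ (X △ Y) × (X △ (⁅ x ⁆ ∪ ⁅ y ⁆)) ∈ₛ D)
      conclude with y , ne , f ← exchange (enc p q X) (enc p q Y) (trivial-∈ X∈D) (trivial-∈ Y∈D) x
                                   (λ eq → xor⇒≢ xor-x (enc-injective X Y x eq))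
        = y , lookup⇒[]= y _ (trans (lookup-△ X Y y) xor-y) ,
          Equivalence.from (D⇔ _) (f (enc p q (X △ (⁅ x ⁆ ∪ ⁅ y ⁆)))
            (flipped xor-x _ (pair-left {x = x} {y})) (flipped xor-y _ (pair-right {x = x})) λ i i≢x i≢y →
            enc-cong (X △ (⁅ x ⁆ ∪ ⁅ y ⁆)) X i (trans (lookup-△ X _ i) (trans (cong (lookup X i xor_) (pair-off i i≢x i≢y)) (xor-identityʳ _))))
        where
        xor-y : lookup X y xor lookup Y y ≡ true
        xor-y = ≢⇒xor (ne ∘ enc-cong X Y y)

    enc-flip-off : ∀ X x → AgreeOff x (enc p q X) (enc p q (X ⊕ ⁅ x ⁆))
    enc-flip-off X x i i≢x = enc-cong X (X ⊕ ⁅ x ⁆) i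
      (sym (trans (lookup-⊕ X ⁅ x ⁆ i) (trans (cong (lookup X i xor_) (lookup-⁅⁆-≢ i≢x)) (xor-identityʳ _))))

    ρ-zero : ∀ X v k i → dev (enc p q X) v k i ≡ false → ρ (lookup v i) (lookup k i) ≡ false
    ρ-zero X v k i eq with lookup X i
    ... | true  = cong (_∧ off q (lookup v i) (lookup k i)) eq
    ... | false = trans (cong (off p (lookup v i) (lookup k i) ∧_) eq) (Bool.∧-zeroʳ _)

    -- At `x` the two neighbours carry the two different letters, so leaving both lines means having
    -- the third type.
    ρ-one : ∀ X x v k → dev (enc p q X) v k x ≡ true → dev (enc p q (X ⊕ ⁅ x ⁆)) v k x ≡ true → ρ (lookup v x) (lookup k x) ≡ true
    ρ-one X x v k eq eq′ with lookup X x | lookup (X ⊕ ⁅ x ⁆) x | trans (lookup-⊕ X ⁅ x ⁆ x) (cong (lookup X x xor_) (lookup-⁅⁆ x))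
    ... | true  | false | _ = cong₂ _∧_ eq eq′
    ... | false | true  | _ = cong₂ _∧_ eq′ eq

    -- ρ flags the coordinates of the third type r, and the sum of κ over all coordinates is the symplectic product with (r, …, r).
    module Parity (κ : Bool → Bool → Bool)
                  (κ-xor : ∀ v k v′ k′ → κ (v xor v′) (k xor k′) ≡ κ v k xor κ v′ k′)
                  (κ≡ : ∀ v k → κ v k ≡ (v ∧ k) xor ρ v k) where

      total : Subset n → Subset n → Bool
      total v k = par (zipWith κ v k)

      total-⊕ : ∀ v k v′ k′ → total (v ⊕ v′) (k ⊕ k′) ≡ total v k xor total v′ k′
      total-⊕ v k v′ k′ = trans
        (par-cong (zipWith κ (v ⊕ v′) (k ⊕ k′)) (zipWith κ v k ⊕ zipWith κ v′ k′) pointwise)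
        (par-⊕ (zipWith κ v k) (zipWith κ v′ k′))
        where
        pointwise : ∀ i → lookup (zipWith κ (v ⊕ v′) (k ⊕ k′)) i ≡ lookup (zipWith κ v k ⊕ zipWith κ v′ k′) i
        pointwise i
          rewrite lookup-⊕ (zipWith κ v k) (zipWith κ v′ k′) i | lookup-zipWith κ i (v ⊕ v′) (k ⊕ k′)
                | lookup-zipWith κ i v k | lookup-zipWith κ i v′ k′ | lookup-⊕ v v′ i | lookup-⊕ k k′ i
          = κ-xor (lookup v i) (lookup k i) (lookup v′ i) (lookup k′ i)

      -- The summand `v ∧ k` of `κ≡` contributes `dot v k`, which is 0 on L × K.
      total≡ρ : ∀ v k → L v → K k → total v k ≡ par (zipWith ρ v k)
      total≡ρ v k v∈L k∈K = begin
        total v k                       ≡⟨ par-cong (zipWith κ v k) ((v ∩ k) ⊕ zipWith ρ v k) pointwise ⟩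
        par ((v ∩ k) ⊕ zipWith ρ v k)   ≡⟨ par-⊕ (v ∩ k) (zipWith ρ v k) ⟩
        dot v k xor par (zipWith ρ v k) ≡⟨ cong (_xor par (zipWith ρ v k)) (L⊥K v∈L k∈K) ⟩
        par (zipWith ρ v k)             ∎
        where
        open ≡-Reasoning
        pointwise : ∀ i → lookup (zipWith κ v k) i ≡ lookup ((v ∩ k) ⊕ zipWith ρ v k) i
        pointwise i
          rewrite lookup-⊕ (v ∩ k) (zipWith ρ v k) i | lookup-zipWith κ i v k | lookup-zipWith _∧_ i v k | lookup-zipWith ρ i v k
          = κ≡ (lookup v i) (lookup k i)

      total-inSpan : ∀ X v k → L v → K k → InSpan (enc p q X) v k → total v k ≡ false
      total-inSpan X v k v∈L k∈K in-X = trans (total≡ρ v k v∈L k∈K)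
        (par-zero (zipWith ρ v k) λ i → trans (lookup-zipWith ρ i v k) (ρ-zero X v k i (at in-X i)))

      Orthogonal : Set
      Orthogonal = ∀ v k → L v → K k → total v k ≡ false

      -- The element of L × K leaving the transversal of `X` only at `x` would leave that of the
      -- neighbour at `x` too. It would have the third type at `x` and nowhere else, so total 1.
      orthogonal⇒not-adjacent : Orthogonal → ∀ X x → X ∈ₛ D → ¬ (X ⊕ ⁅ x ⁆) ∈ₛ D
      orthogonal⇒not-adjacent orth X x X∈D X′∈D
        with v , k , v∈L , k∈K , at-x , off-x ← complement-at (enc p q X) (trivial-∈ X∈D) x
        = contradiction (trans (sym total-true) (orth v k v∈L k∈K)) λ ()
        where
        at-x′ : dev (enc p q (X ⊕ ⁅ x ⁆)) v k x ≡ true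
        at-x′ = ¬-not λ eq → contradiction (trans (sym at-x) (dev-⊥ (enc p q X) x
          (trivial-∈ X′∈D v k v∈L k∈K (inSpan-off x (enc-flip-off X x) off-x eq)))) λ ()
        total-true : total v k ≡ true
        total-true = begin
          total v k                     ≡⟨ total≡ρ v k v∈L k∈K ⟩
          par (zipWith ρ v k)           ≡⟨ par-single (zipWith ρ v k) x (λ i i≢x → trans (lookup-zipWith ρ i v k) (ρ-zero X v k i (off-x i i≢x))) ⟩
          lookup (zipWith ρ v k) x      ≡⟨ lookup-zipWith ρ x v k ⟩
          ρ (lookup v x) (lookup k x)   ≡⟨ ρ-one X x v k at-x at-x′ ⟩
          true                          ∎
          where open ≡-Reasoning

      -- Walk from `X` to `Y` by exchanges. Since no two members are adjacent, each exchange has `y`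
      -- different from `x` and keeps the parity, while the symmetric difference with `Y` shrinks.
      orthogonal⇒even : Orthogonal → IsEven D
      orthogonal⇒even orth X Y X∈D Y∈D = trans (∣∣%2 X) (trans (cong (if_then 1 else 0) (walk X X∈D (⊂-wellFounded _))) (sym (∣∣%2 Y)))
        where
        walk : ∀ X → X ∈ₛ D → Acc _⊂_ (X △ Y) → par X ≡ par Y
        walk X X∈D (acc rec) with any? (λ x → lookup X x xor lookup Y x Bool.≟ true)
        ... | no none = par-cong X Y (λ i → xor-false⇒≡ (¬-not λ eq → none (i , eq)))
        ... | yes (x , ne) with y , y∈ , X′∈D ← Δ-exchange X Y x X∈D Y∈D (lookup⇒[]= x _ (trans (lookup-△ X Y x) ne)) | x ≟ y
        ...   | yes refl = contradiction (subst (_∈ₛ D) (trans (△≡⊕ X _) (cong (X ⊕_) (∪-idem ⁅ x ⁆))) X′∈D) (orthogonal⇒not-adjacent orth X x X∈D)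
        ...   | no x≢y = trans (sym (par-△-pair X x≢y)) (walk X′ X′∈D (rec (sub , x , lookup⇒[]= x _ (trans (lookup-△ X Y x) ne) , x∉)))
          where
          X′ : Subset n
          X′ = X △ (⁅ x ⁆ ∪ ⁅ y ⁆)
          flipped : ∀ i → lookup X i xor lookup Y i ≡ true → lookup (⁅ x ⁆ ∪ ⁅ y ⁆) i ≡ true → lookup (X′ △ Y) i ≡ false
          flipped i ne eq rewrite lookup-△ X′ Y i | lookup-△ X (⁅ x ⁆ ∪ ⁅ y ⁆) i | eq | xor-true {lookup X i} {lookup Y i} ne = xor-same (lookup Y i)
          x∉ : x ∉ X′ △ Y
          x∉ x∈ = contradiction (trans (sym ([]=⇒lookup x∈)) (flipped x ne (pair-left {x = x} {y}))) λ ()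
          sub : X′ △ Y ⊆ X △ Y
          sub {i} i∈ with i ≟ x | i ≟ y
          ... | yes refl | _ = contradiction i∈ x∉
          ... | no _ | yes refl = y∈
          ... | no i≢x | no i≢y = lookup⇒[]= i _ (trans (trans (lookup-△ X Y i)
              (cong (_xor lookup Y i) (sym (trans (lookup-△ X _ i) (trans (cong (lookup X i xor_) (pair-off i i≢x i≢y)) (xor-identityʳ (lookup X i)))))))
              (trans (sym (lookup-△ X′ Y i)) ([]=⇒lookup i∈)))

      -- The nonzero members of the spans at the neighbours of X generate L × K, and each of them has total 0.
      even⇒orthogonal : IsEven D → ∃[ X ] X ∈ₛ D → Orthogonal
      even⇒orthogonal even (X , X∈D) v k v∈L k∈K = reduce (allFin n) v k v∈L k∈K λ i _ → ∈-allFin i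
        where
        t : Fin n → Ty
        t = enc p q X
        generator : ∀ j → ∃₂ (Witness (enc p q (X ⊕ ⁅ j ⁆)))
        generator j = nontrivial⇒witness λ triv →
          par-flip X j (∣∣%2-injective (X ⊕ ⁅ j ⁆) X (even (X ⊕ ⁅ j ⁆) X (Equivalence.from (D⇔ _) triv) X∈D))
        -- The list covers the coordinates where `(v, k)` leaves `t`. The generator at `j` leaves
        -- `t` exactly at `j`, so adding it removes `j` from the list without changing the total.
        reduce : ∀ js v k → L v → K k → (∀ i → dev t v k i ≡ true → i ∈ˡ js) → total v k ≡ false
        reduce [] v k v∈L k∈K h = total-inSpan X v k v∈L k∈K (inSpan λ i → ¬-not λ eq → contradiction (h i eq) λ ())
        reduce (j ∷ js) v k v∈L k∈K h with dev t v k j in eq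
        ... | false = reduce js v k v∈L k∈K h′
          where
          h′ : ∀ i → dev t v k i ≡ true → i ∈ˡ js
          h′ i eq′ with h i eq′
          ... | here refl = contradiction (trans (sym eq′) eq) λ ()
          ... | there i∈  = i∈
        ... | true with w , l , w∈L , l∈K , in-j , nz ← generator j = begin
          total v k                  ≡⟨ xor-identityʳ (total v k) ⟨
          total v k xor false        ≡⟨ cong (total v k xor_) (total-inSpan (X ⊕ ⁅ j ⁆) w l w∈L l∈K in-j) ⟨
          total v k xor total w l    ≡⟨ total-⊕ v k w l ⟨
          total (v ⊕ w) (k ⊕ l)      ≡⟨ reduce js (v ⊕ w) (k ⊕ l) (L-⊕ v∈L w∈L) (K-⊕ k∈K l∈K) h′ ⟩
          false                      ∎
          where
          open ≡-Reasoning
          flip~t : AgreeOff j (enc p q (X ⊕ ⁅ j ⁆)) t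
          flip~t i i≢j = sym (enc-flip-off X j i i≢j)
          dev-j : dev t w l j ≡ true
          dev-j = ¬-not λ eq → nz (trivial-∈ X∈D w l w∈L l∈K (inSpan-off j flip~t (λ i _ → at in-j i) eq))
          dev-off : ∀ i → i ≢ j → dev t w l i ≡ false
          dev-off i i≢j = trans (off-cong w l i (sym (flip~t i i≢j))) (at in-j i)
          h′ : ∀ i → dev t (v ⊕ w) (k ⊕ l) i ≡ true → i ∈ˡ js
          h′ i eq′ with i ≟ j
          ... | yes refl = contradiction (trans (sym eq′) (trans (dev-⊕ t v k w l j) (cong₂ _xor_ eq dev-j))) λ ()
          ... | no i≢j with h i (trans (sym (xor-identityʳ _)) (trans (cong (dev t v k i xor_) (sym (dev-off i i≢j))) (trans (sym (dev-⊕ t v k w l i)) eq′)))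
          ...   | here refl = contradiction refl i≢j
          ...   | there i∈  = i∈

-- Binary matroids

module Representation {m n : ℕ} (A : Matrix₂ m n) where

  K : Subset n → Set
  K S = colSum A S ≡ replicate m false

  row : Fin m → Subset n
  row i = tabulate (A i)

  K? : ∀ S → Dec (K S)
  K? S = ≡-dec Bool._≟_ (colSum A S) (replicate m false)

  lookup-colSum : ∀ S i → lookup (colSum A S) i ≡ dot S (row i)
  lookup-colSum S i = lookup∘tabulate (λ i → dot S (row i)) i

  colSum-⊕ : ∀ S T → colSum A (S ⊕ T) ≡ colSum A S ⊕ colSum A T
  colSum-⊕ S T = vec-ext λ i → trans (lookup-colSum (S ⊕ T) i) (trans (dot-⊕ˡ S T (row i))
    (sym (trans (lookup-⊕ (colSum A S) (colSum A T) i) (cong₂ _xor_ (lookup-colSum S i) (lookup-colSum T i)))))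

  K-⊥ : K ⊥
  K-⊥ = vec-ext λ i → trans (lookup-colSum ⊥ i) (trans (dot-⊥ˡ (row i)) (sym (lookup-⊥ i)))

  K-⊕ : ∀ S T → K S → K T → K (S ⊕ T)
  K-⊕ S T S∈K T∈K = trans (colSum-⊕ S T) (trans (cong₂ _⊕_ S∈K T∈K) (⊕-self _))

  colSum-≡⇒K : ∀ S T → colSum A S ≡ colSum A T → K (S ⊕ T)
  colSum-≡⇒K S T eq = trans (colSum-⊕ S T) (trans (cong (_⊕ colSum A T) eq) (⊕-self _))

  colSum-⁅⁆ : ∀ j → colSum A ⁅ j ⁆ ≡ column A j
  colSum-⁅⁆ j = tabulate-cong λ i → trans (dot-comm ⁅ j ⁆ (row i)) (trans (dot-⁅⁆ʳ (row i) j) (lookup∘tabulate (A i) j))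

  K⇒colSum : ∀ S j → K S → colSum A (S ⊕ ⁅ j ⁆) ≡ column A j
  K⇒colSum S j S∈K = trans (colSum-⊕ S ⁅ j ⁆) (trans (cong₂ _⊕_ S∈K (colSum-⁅⁆ j))
    (vec-ext λ i → trans (lookup-⊕ (replicate m false) (column A j) i) (cong (_xor lookup (column A j) i) (lookup-⊥ i))))

  -- Taken as the orthogonal complement of `K` rather than the row space, which makes isotropy
  -- immediate.
  L : Subset n → Set
  L v = ∀ k → K k → dot v k ≡ false

  L? : ∀ v → Dec (L v)
  L? v with anySubset? (λ k → K? k ×-dec (dot v k Bool.≟ true))
  ... | yes (k , k∈K , eq) = no λ v∈L → contradiction (trans (sym eq) (v∈L k k∈K)) λ ()
  ... | no none = yes λ k k∈K → ¬-not λ eq → none (k , k∈K , eq)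

  dependent? : ∀ I → Dec (∃[ S ] (S ⊆ I × K S × S ≢ ⊥))
  dependent? I = anySubset? λ S → S ⊆? I ×-dec K? S ×-dec ¬? (≡-dec Bool._≟_ S ⊥)

  ¬dependent⇒LinIndep : ∀ {I} → ¬ (∃[ S ] (S ⊆ I × K S × S ≢ ⊥)) → LinIndep A I
  ¬dependent⇒LinIndep none S S⊆I S∈K = decidable-stable (≡-dec Bool._≟_ S ⊥) λ S≢⊥ → none (S , S⊆I , S∈K , S≢⊥)

  InClosure : Subset n → Fin n → Set
  InClosure I j = ∃[ S ] (S ⊆ I × colSum A S ≡ column A j)

  ∈⇒InClosure : ∀ {I j} → j ∈ I → InClosure I j
  ∈⇒InClosure {I} {j} j∈I = ⁅ j ⁆ , (λ x∈ → subst (_∈ I) (sym (x∈⁅y⁆⇒x≡y j x∈)) j∈I) , colSum-⁅⁆ j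

  InClosure-mono : ∀ {I J} → I ⊆ J → ∀ {j} → InClosure I j → InClosure J j
  InClosure-mono I⊆J (S , S⊆I , eq) = S , (λ x∈ → I⊆J (S⊆I x∈)) , eq

  -- Greedy extension: `j` is added unless this creates a dependency, and then `j` is already in the
  -- closure.
  extend : ∀ js {I} → LinIndep A I → ∃[ J ] (I ⊆ J × LinIndep A J × All (InClosure J) js)
  extend []       {I} indep = I , (λ x∈ → x∈) , indep , []
  extend (j ∷ js) {I} indep with J , I⊆J , indep-J , closed ← extend js indep | dependent? (J ∪ ⁅ j ⁆)
  ... | no none = J ∪ ⁅ j ⁆ , (λ x∈ → p⊆p∪q _ (I⊆J x∈)) , ¬dependent⇒LinIndep none ,
        ∈⇒InClosure (q⊆p∪q J _ (x∈⁅x⁆ j)) ∷ All.map (InClosure-mono (p⊆p∪q ⁅ j ⁆)) closed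
  -- As `J` is independent, the dependency `S` contains `j`; dropping `j` expresses its column
  -- through `J`.
  ... | yes (S , S⊆ , S∈K , S≢⊥) = J , I⊆J , indep-J , (S ⊕ ⁅ j ⁆ , ⊕⁅⁆-⊆ off-j at-j , K⇒colSum S j S∈K) ∷ closed
    where
    off-j : ∀ i → i ≢ j → i ∈ S → i ∈ J
    off-j i i≢j i∈S with x∈p∪q⁻ J ⁅ j ⁆ (S⊆ i∈S)
    ... | inj₁ i∈J = i∈J
    ... | inj₂ i∈j = contradiction (x∈⁅y⁆⇒x≡y j i∈j) i≢j
    at-j : lookup S j ≡ false → j ∈ J
    at-j eq = contradiction (indep-J S (λ {i} i∈S → off-j i (λ { refl → contradiction (trans (sym ([]=⇒lookup i∈S)) eq) λ () }) i∈S) S∈K) S≢⊥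

  extend-to-basis : ∀ {I} → LinIndep A I → ∃[ J ] (I ⊆ J × ColumnBasis A J)
  extend-to-basis indep with J , I⊆J , indep-J , closed ← extend (allFin n) indep =
    J , I⊆J , indep-J , λ j → All.lookup closed (∈-allFin j)

  -- The Lagrangian subspace attached to a basis

  module Basis {B : Subset n} (indep : LinIndep A B) (spans : Spans A B) where

    S : Fin n → Subset n
    S j = proj₁ (spans j)

    -- The projection onto GF(2)^B along K, and its transpose.
    P Pᵗ : Subset n → Subset n
    P w  = comb w S
    Pᵗ u = tabulate (dot u ∘ S)

    S-outside : ∀ j i → lookup B i ≡ false → lookup (S j) i ≡ false
    S-outside j i eq = ¬-not λ eq′ → contradiction
      (trans (sym ([]=⇒lookup (proj₁ (proj₂ (spans j)) (lookup⇒[]= i (S j) eq′)))) eq) λ ()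

    P-outside : ∀ w i → lookup B i ≡ false → lookup (P w) i ≡ false
    P-outside w i eq = comb-zero w S i λ j → S-outside j i eq

    colSum-P : ∀ w → colSum A (P w) ≡ colSum A w
    colSum-P w = tabulate-cong λ i → trans (dot-comm (P w) (row i)) (trans (dot-comb (row i) w S)
      (trans (cong (λ u → dot u w) (tabulate-cong λ j → entry i j)) (dot-comm (row i) w)))
      where
      entry : ∀ i j → dot (row i) (S j) ≡ A i j
      entry i j = trans (dot-comm (row i) (S j)) (trans (sym (lookup-colSum (S j) i))
        (trans (cong (λ z → lookup z i) (proj₂ (proj₂ (spans j)))) (lookup∘tabulate (λ i → A i j) i)))

    -- `P k` lies inside the independent set `B` and has the same column sum as `k`, namely 0.
    P-K : ∀ k → K k → P k ≡ ⊥
    P-K k k∈K = indep (P k) (λ {i} i∈ → lookup⇒[]= i B (¬-not {lookup B i} {false} λ eq →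
      contradiction (trans (sym ([]=⇒lookup i∈)) (P-outside k i eq)) λ ())) (trans (colSum-P k) k∈K)

    K-P : ∀ k → P k ≡ ⊥ → K k
    K-P k eq = trans (sym (colSum-P k)) (trans (cong (colSum A) eq) K-⊥)

    -- By adjointness, pairing `Pᵗ u` with `k` is pairing `u` with `P k`, which is 0 on cycles.
    Pᵗ∈L : ∀ u → L (Pᵗ u)
    Pᵗ∈L u k k∈K = trans (sym (dot-comb u k S)) (trans (cong (dot u) (P-K k k∈K)) (dot-⊥ʳ u))

    S-inside : ∀ i → lookup B i ≡ true → S i ≡ ⁅ i ⁆
    S-inside i eq = ⊕≡⊥⇒≡ (indep (S i ⊕ ⁅ i ⁆) (⊕⁅⁆-⊆ (λ _ _ → proj₁ (proj₂ (spans i))) (λ _ → lookup⇒[]= i B eq))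
      (colSum-≡⇒K (S i) ⁅ i ⁆ (trans (proj₂ (proj₂ (spans i))) (sym (colSum-⁅⁆ i)))))

    lookup-Pᵗ : ∀ u i → lookup B i ≡ true → lookup (Pᵗ u) i ≡ lookup u i
    lookup-Pᵗ u i eq = trans (lookup∘tabulate (dot u ∘ S) i) (trans (cong (dot u) (S-inside i eq)) (dot-⁅⁆ʳ u i))

    lookup-⊕P : ∀ u i → lookup B i ≡ false → lookup (u ⊕ P u) i ≡ lookup u i
    lookup-⊕P u i eq = trans (lookup-⊕ u (P u) i) (trans (cong (lookup u i xor_) (P-outside u i eq)) (xor-identityʳ _))

    -- `Pᵗ u` agrees with `u` on `B` and `u ⊕ P u` agrees with `u` off `B`, so together they
    -- determine `u`.
    lagrangian : Lagrangian n
    lagrangian = record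
      { L = L ; K = K ; L? = L? ; K? = K?
      ; L-⊕ = λ {v} {v′} v∈L v′∈L k k∈K → trans (dot-⊕ˡ v v′ k) (cong₂ _xor_ (v∈L k k∈K) (v′∈L k k∈K))
      ; K-⊕ = λ {k} {k′} → K-⊕ k k′
      ; L⊥K = λ {v} {k} v∈L k∈K → v∈L k k∈K
      ; φ = Pᵗ ; ψ = λ u → u ⊕ P u
      ; φ∈L = Pᵗ∈L
      ; ψ∈K = λ u → colSum-≡⇒K u (P u) (sym (colSum-P u))
      ; φψ-injective = λ {u} {w} eq eq′ → vec-ext (injective u w eq eq′)
      }
      where
      injective : ∀ u w → Pᵗ u ≡ Pᵗ w → u ⊕ P u ≡ w ⊕ P w → ∀ i → lookup u i ≡ lookup w i
      injective u w eq eq′ i with lookup B i in inB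
      ... | true  = trans (sym (lookup-Pᵗ u i inB)) (trans (cong (λ z → lookup z i) eq) (lookup-Pᵗ w i inB))
      ... | false = trans (sym (lookup-⊕P u i inB)) (trans (cong (λ z → lookup z i) eq′) (lookup-⊕P w i inB))

    -- Pairing `k` with the element `Pᵗ ⁅ i ⁆` of `L` reads off coordinate `i` of `P k`, and `P k`
    -- is 0 only for cycles.
    K⊥⊥⊆K : ∀ k → (∀ v → L v → dot v k ≡ false) → K k
    K⊥⊥⊆K k orth = K-P k (vec-ext λ i → trans (coordinate i) (sym (lookup-⊥ i)))
      where
      coordinate : ∀ i → lookup (P k) i ≡ false
      coordinate i = trans (sym (dot-⁅⁆ʳ (P k) i)) (trans (dot-comm (P k) ⁅ i ⁆)
        (trans (dot-comb ⁅ i ⁆ k S) (orth (Pᵗ ⁅ i ⁆) (Pᵗ∈L ⁅ i ⁆))))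

    open Transversals lagrangian public

    -- Here `k` is a cycle inside the independent set `W`, hence 0. As `v` vanishes on `W` and is
    -- orthogonal to the cycle formed by `j` and its expression in `W`, it vanishes at every `j`.
    basis⇒trivial : ∀ {W} → ColumnBasis A W → Trivial (enc ⟨01⟩ ⟨10⟩ W)
    basis⇒trivial {W} (indep-W , spans-W) v k v∈L k∈K in-W =
      vec-ext (λ j → trans (v-zero j) (sym (lookup-⊥ j))) , indep-W k k⊆W k∈K
      where
      v-on : ∀ i → lookup W i ≡ true → lookup v i ≡ false
      v-on i eq = trans (off-cong v k i (cong (if_then ⟨01⟩ else ⟨10⟩) (sym eq))) (InSpan.at in-W i)
      k-off : ∀ i → lookup W i ≡ false → lookup k i ≡ false
      k-off i eq = trans (off-cong v k i (cong (if_then ⟨01⟩ else ⟨10⟩) (sym eq))) (InSpan.at in-W i)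
      k⊆W : k ⊆ W
      k⊆W {i} i∈k = lookup⇒[]= i W (¬-not {lookup W i} {false} λ eq → contradiction (trans (sym ([]=⇒lookup i∈k)) (k-off i eq)) λ ())
      v-zero : ∀ j → lookup v j ≡ false
      v-zero j with T , T⊆W , eq ← spans-W j = begin
        lookup v j                   ≡⟨ dot-⁅⁆ʳ v j ⟨
        dot v ⁅ j ⁆                  ≡⟨ cong (_xor dot v ⁅ j ⁆) (dot-disjoint v T λ i i∈T → v-on i ([]=⇒lookup (T⊆W (lookup⇒[]= i T i∈T)))) ⟨
        dot v T xor dot v ⁅ j ⁆      ≡⟨ dot-⊕ʳ v T ⁅ j ⁆ ⟨
        dot v (T ⊕ ⁅ j ⁆)            ≡⟨ v∈L (T ⊕ ⁅ j ⁆) (colSum-≡⇒K T ⁅ j ⁆ (trans eq (sym (colSum-⁅⁆ j)))) ⟩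
        false                        ∎
        where open ≡-Reasoning

    -- A cycle `T` inside `W` gives the element (0, T) of the span, so it is 0. For `j` off `W`, the
    -- element deviating only at `j` provides the fundamental cycle of `j`.
    trivial⇒basis : ∀ {W} → Trivial (enc ⟨01⟩ ⟨10⟩ W) → ColumnBasis A W
    trivial⇒basis {W} triv = indep-W , spans-W
      where
      indep-W : LinIndep A W
      indep-W T T⊆W T∈K = proj₂ (triv ⊥ T (λ k _ → dot-⊥ˡ k) T∈K (inSpan in-W))
        where
        in-W : ∀ i → dev (enc ⟨01⟩ ⟨10⟩ W) ⊥ T i ≡ false
        in-W i with lookup W i in eq
        ... | true  = lookup-⊥ i
        ... | false = ¬-not λ eq′ → contradiction (trans (sym ([]=⇒lookup (T⊆W (lookup⇒[]= i T eq′)))) eq) λ ()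
      closure : ∀ {j} → lookup W j ≡ false →
        (∃₂ λ v k → L v × K k × dev (enc ⟨01⟩ ⟨10⟩ W) v k j ≡ true × (∀ i → i ≢ j → dev (enc ⟨01⟩ ⟨10⟩ W) v k i ≡ false)) →
        InClosure W j
      closure {j} j∉W (v , k , v∈L , k∈K , at-j , off-j) =
        k ⊕ ⁅ j ⁆ , ⊕⁅⁆-⊆ inside-W (λ eq → contradiction (trans (sym k-j) eq) λ ()) , K⇒colSum k j k∈K
        where
        k-j : lookup k j ≡ true
        k-j = trans (off-cong v k j (cong (if_then ⟨01⟩ else ⟨10⟩) (sym j∉W))) at-j
        inside-W : ∀ i → i ≢ j → i ∈ k → i ∈ W
        inside-W i i≢j i∈k = lookup⇒[]= i W (¬-not {lookup W i} {false} λ eq → contradiction (trans (sym ([]=⇒lookup i∈k))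
          (trans (off-cong v k i (cong (if_then ⟨01⟩ else ⟨10⟩) (sym eq))) (off-j i i≢j))) λ ())
      spans-W : Spans A W
      spans-W j with lookup W j in eq
      ... | true  = ∈⇒InClosure (lookup⇒[]= j W eq)
      ... | false = closure eq (complement-at (enc ⟨01⟩ ⟨10⟩ W) triv j)

-- Circuits and the cycle space

module Circuits {m n : ℕ} (A : Matrix₂ m n) (M : SetSystem n) (M⇔ : ∀ X → X ∈ₛ M ⇔ ColumnBasis A X) where
  open Representation A

  LinIndep⇒Independent : ∀ {I} → LinIndep A I → Independent M I
  LinIndep⇒Independent indep with J , I⊆J , basis ← extend-to-basis indep = J , Equivalence.from (M⇔ J) basis , I⊆J

  Independent⇒LinIndep : ∀ {I} → Independent M I → LinIndep A I
  Independent⇒LinIndep (X , X∈M , I⊆X) S S⊆I = proj₁ (Equivalence.to (M⇔ X) X∈M) S (λ x∈ → I⊆X (S⊆I x∈))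

  -- A circuit contains a nonempty cycle, which cannot be a proper subset because proper subsets of
  -- a circuit are independent.
  circuit∈K : ∀ C → Circuit M C → K C
  circuit∈K C (¬indep , minimal) with dependent? C
  ... | no none = contradiction (LinIndep⇒Independent (¬dependent⇒LinIndep none)) ¬indep
  ... | yes (S , S⊆C , S∈K , S≢⊥) with C ⊆? S
  ...   | yes C⊆S = subst K (⊆-antisym S⊆C C⊆S) S∈K
  ...   | no C⊈S  = contradiction (Independent⇒LinIndep (minimal S (⊆∧⊈⇒⊂ S⊆C C⊈S)) S (λ x∈ → x∈) S∈K) S≢⊥

  minimal⇒circuit : ∀ k → K k → k ≢ ⊥ → ¬ (∃[ S ] (S ⊂ k × K S × S ≢ ⊥)) → Circuit M k
  minimal⇒circuit k k∈K k≢⊥ none =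
    (λ indep → k≢⊥ (Independent⇒LinIndep indep k (λ x∈ → x∈) k∈K)) ,
    λ D D⊂k → LinIndep⇒Independent (¬dependent⇒LinIndep λ (S , S⊆D , S∈K , S≢⊥) → none (S , ⊆-⊂-trans S⊆D D⊂k , S∈K , S≢⊥))

  contains-circuit : ∀ k → Acc _⊂_ k → K k → k ≢ ⊥ → ∃[ C ] (Circuit M C × C ⊆ k × C ≢ ⊥)
  contains-circuit k (acc rec) k∈K k≢⊥ with anySubset? (λ S → S ⊂? k ×-dec K? S ×-dec ¬? (≡-dec Bool._≟_ S ⊥))
  ... | no none = k , minimal⇒circuit k k∈K k≢⊥ none , (λ x∈ → x∈) , k≢⊥
  ... | yes (S , S⊂k , S∈K , S≢⊥) with C , circuit , C⊆S , C≢⊥ ← contains-circuit S (rec S⊂k) S∈K S≢⊥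
      = C , circuit , (λ x∈ → proj₁ S⊂k (C⊆S x∈)) , C≢⊥

  DisjointCircuits : Subset n → Set
  DisjointCircuits k = ∃[ Cs ] (All (Circuit M) Cs × AllPairs (λ C C′ → C ∩ C′ ≡ ⊥) Cs × List.foldr _∪_ ⊥ Cs ≡ k)

  -- Split off a circuit `C` contained in `k`; what is left, `k ⊕ C`, is a smaller cycle disjoint
  -- from `C`.
  decompose : ∀ k → Acc _⊂_ k → K k → DisjointCircuits k
  decompose k (acc rec) k∈K with ≡-dec Bool._≟_ k ⊥
  ... | yes k≡⊥ = [] , [] , [] , sym k≡⊥
  ... | no k≢⊥ with C , circuit , C⊆k , C≢⊥ ← contains-circuit k (⊂-wellFounded k) k∈K k≢⊥
      = conclude (decompose (k ⊕ C) (rec k⊕C⊂k) (K-⊕ k C k∈K (circuit∈K C circuit)))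
    where
    inside-k : ∀ i → lookup C i ≡ true → lookup k i ≡ true
    inside-k i eq = []=⇒lookup (C⊆k (lookup⇒[]= i C eq))
    disjoint : ∀ i → i ∈ C → i ∉ k ⊕ C
    disjoint i i∈C i∈ with () ← trans (sym (∈-⊕⁻ {X = k} {C} i∈)) (cong₂ _xor_ (inside-k i ([]=⇒lookup i∈C)) ([]=⇒lookup i∈C))
    k⊕C⊂k : k ⊕ C ⊂ k
    k⊕C⊂k = (λ {i} → sub i) , in-C
      where
      sub : ∀ i → i ∈ k ⊕ C → i ∈ k
      sub i i∈ with i ∈? C
      ... | yes i∈C = contradiction i∈ (disjoint i i∈C)
      ... | no i∉C  = lookup⇒[]= i k (trans (sym (xor-identityʳ _))
        (trans (cong (lookup k i xor_) (sym (∉⇒lookup i∉C))) (∈-⊕⁻ {X = k} {C} i∈)))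
      in-C : ∃[ i ] (i ∈ k × i ∉ k ⊕ C)
      in-C with nonempty? C
      ... | yes (i , i∈C) = i , C⊆k i∈C , disjoint i i∈C
      ... | no empty      = contradiction (Empty-unique empty) C≢⊥
    conclude : DisjointCircuits (k ⊕ C) → DisjointCircuits k
    conclude (Cs , circuits , pairs , union) = C ∷ Cs , circuit ∷ circuits , apart ∷ pairs ,
      trans (cong (C ∪_) union) (vec-ext λ i → trans (lookup-zipWith _∨_ i C (k ⊕ C))
        (trans (cong (lookup C i ∨_) (lookup-⊕ k C i)) (refill i)))
      where
      apart : All (λ C′ → C ∩ C′ ≡ ⊥) Cs
      apart = All.map (λ {C′} h → Empty-unique λ (i , i∈) →
        disjoint i (proj₁ (x∈p∩q⁻ C C′ i∈)) (subst (i ∈_) union (h i (proj₂ (x∈p∩q⁻ C C′ i∈))))) (∈-⋃ Cs)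
      refill : ∀ i → lookup C i ∨ (lookup k i xor lookup C i) ≡ lookup k i
      refill i with lookup C i in eq
      ... | true  = sym (inside-k i eq)
      ... | false = xor-identityʳ (lookup k i)

  -- Circuits are cycles, and every cycle is a disjoint union of circuits.
  bipartite⇔ : Bipartite M ⇔ (∀ k → K k → par k ≡ false)
  bipartite⇔ = mk⇔ to from
    where
    even-par : ∀ {C} → 2 ∣ ∣ C ∣ → par C ≡ false
    even-par {C} 2∣C = trans (∣∣%2-injective C (⊥ {n}) (trans (n∣m⇒m%n≡0 ∣ C ∣ 2 2∣C) (sym (trans (∣∣%2 (⊥ {n})) (cong (if_then 1 else 0) (par-⊥ n)))))) (par-⊥ n)
    to : Bipartite M → ∀ k → K k → par k ≡ false
    to bip k k∈K with Cs , circuits , pairs , union ← decompose k (⊂-wellFounded k) k∈K =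
      subst (λ z → par z ≡ false) union (disjoint-⋃-closed (λ z → par z ≡ false) (par-⊥ n)
        (λ {C} {R} p q → trans (par-⊕ C R) (cong₂ _xor_ p q)) (All.map (λ {C} c → even-par {C} (bip C c)) circuits) pairs)
    from : (∀ k → K k → par k ≡ false) → Bipartite M
    from even C circuit = m%n≡0⇒n∣m ∣ C ∣ 2 (trans (∣∣%2 C) (cong (if_then 1 else 0) (even C (circuit∈K C circuit))))

  eulerian⇔ : Eulerian M ⇔ K ⊤
  eulerian⇔ = mk⇔
    (λ (Cs , circuits , pairs , union) → subst K union (disjoint-⋃-closed K K-⊥ (λ {C} {R} → K-⊕ C R) (All.map (λ {C} → circuit∈K C) circuits) pairs))
    (decompose ⊤ (⊂-wellFounded ⊤))

-- Loop complementation and dual pivot of a binary matroid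

≡true-ext : ∀ {a b} → a ≡ true ⇔ b ≡ true → a ≡ b
≡true-ext {true}          eqv = sym (Equivalence.to eqv refl)
≡true-ext {false} {false} eqv = refl
≡true-ext {false} {true}  eqv = Equivalence.from eqv refl

theorem5 : (n : ℕ) (M : SetSystem n) → IsMatroid M → IsBinary M →
    (Bipartite M ⇔ (IsEven (M +ₗ ⊤) × IsΔMatroid (M +ₗ ⊤))) ×
    (Eulerian M ⇔ (IsEven (M *̄ ⊤) × IsΔMatroid (M *̄ ⊤)))
theorem5 n M ((B , B∈M) , _) (m , A , M⇔) =
  mk⇔ (λ bip → +-even⇐ (λ v k _ k∈K → trans (cong par (second v k)) (Equivalence.to bipartite⇔ bip k k∈K)) , +-Δ)
      (λ (even , _) → Equivalence.from bipartite⇔ λ k k∈K →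
        -- The total of the element (0, k) of L × K is the parity of `k`.
        trans (cong par (sym (second ⊥ k))) (+-even⇒ even (B , B∈+) ⊥ k (λ l _ → dot-⊥ˡ l) k∈K)) ,
  mk⇔ (λ eul → *-even⇐ (λ v k v∈L _ → trans (cong par (first v k))
        (trans (sym (dot-⊤ʳ v)) (v∈L ⊤ (Equivalence.to eulerian⇔ eul)))) , *-Δ)
      -- Testing with (v, 0) shows that every `v` in `L` has even size, so V lies in the double
      -- complement of `K`.
      (λ (even , _) → Equivalence.from eulerian⇔ (K⊥⊥⊆K ⊤ λ v v∈L →
        trans (dot-⊤ʳ v) (trans (cong par (sym (first v ⊥))) (*-even⇒ even (B , B∈*) v ⊥ v∈L K-⊥))))
  where
  open Representation A
  open Circuits A M M⇔
  open Basis {B} (proj₁ (Equivalence.to (M⇔ B) B∈M)) (proj₂ (Equivalence.to (M⇔ B) B∈M))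

  indicator-letters : ∀ p q Y → indicator (letters p q Y) ≡ true ⇔ Trivial (enc p q Y)
  indicator-letters p q Y = mk⇔
    (λ eq → Trivial-cong (lookup-letters p q Y) (Equivalence.to (indicator⇔ (letters p q Y)) eq))
    (λ triv → Equivalence.from (indicator⇔ (letters p q Y)) (Trivial-cong (λ i → sym (lookup-letters p q Y i)) triv))

  M≡indicator : ∀ W → M W ≡ indicator (letters ⟨01⟩ ⟨10⟩ W)
  M≡indicator W = ≡true-ext (mk⇔
    (Equivalence.from (indicator-letters ⟨01⟩ ⟨10⟩ W) ∘ basis⇒trivial ∘ Equivalence.to (M⇔ W))
    (Equivalence.from (M⇔ W) ∘ trivial⇒basis ∘ Equivalence.to (indicator-letters ⟨01⟩ ⟨10⟩ W)))

  +⇔ : ∀ Y → Y ∈ₛ (M +ₗ ⊤) ⇔ Trivial (enc ⟨11⟩ ⟨10⟩ Y)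
  +⇔ Y = subst (λ b → b ≡ true ⇔ Trivial (enc ⟨11⟩ ⟨10⟩ Y)) (sym (trans (+ₗ⊤≡parity M Y)
    (trans (parity-cong λ W → cong (does (W ⊆? Y) ∧_) (M≡indicator W)) (parity-below indicator indicator-threeTerm Y))))
    (indicator-letters ⟨11⟩ ⟨10⟩ Y)

  *⇔ : ∀ Y → Y ∈ₛ (M *̄ ⊤) ⇔ Trivial (enc ⟨01⟩ ⟨11⟩ Y)
  *⇔ Y = subst (λ b → b ≡ true ⇔ Trivial (enc ⟨01⟩ ⟨11⟩ Y)) (sym (trans (*̄⊤≡parity M Y)
    (trans (parity-cong λ W → cong (does (Y ⊆? W) ∧_) (M≡indicator W)) (parity-above indicator indicator-threeTerm Y))))
    (indicator-letters ⟨01⟩ ⟨11⟩ Y)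

  trivial-B : Trivial (enc ⟨01⟩ ⟨10⟩ B)
  trivial-B = basis⇒trivial (Equivalence.to (M⇔ B) B∈M)

  -- The basis itself witnesses nonemptiness: `k` vanishes off `B`, hence everywhere; then `v`
  -- vanishes on `B`, hence everywhere.
  B∈+ : B ∈ₛ (M +ₗ ⊤)
  B∈+ = Equivalence.from (+⇔ B) triv
    where
    triv : Trivial (enc ⟨11⟩ ⟨10⟩ B)
    triv v k v∈L k∈K in-B = proj₁ (trivial-B v ⊥ v∈L K-⊥ (inSpan v-span)) , k≡⊥
      where
      k-span : ∀ i → dev (enc ⟨01⟩ ⟨10⟩ B) ⊥ k i ≡ false
      k-span i with lookup B i | InSpan.at in-B i
      ... | true  | _  = lookup-⊥ i
      ... | false | eq = eq
      k≡⊥ : k ≡ ⊥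
      k≡⊥ = proj₂ (trivial-B ⊥ k (λ l _ → dot-⊥ˡ l) k∈K (inSpan k-span))
      v-span : ∀ i → dev (enc ⟨01⟩ ⟨10⟩ B) v ⊥ i ≡ false
      v-span i with lookup B i | InSpan.at in-B i
      ... | true  | eq = trans (xor-false⇒≡ eq) (trans (cong (λ z → lookup z i) k≡⊥) (lookup-⊥ i))
      ... | false | _  = lookup-⊥ i

  -- Dually, `v` vanishes on `B` and so is 0, which makes `k` vanish off `B`.
  B∈* : B ∈ₛ (M *̄ ⊤)
  B∈* = Equivalence.from (*⇔ B) triv
    where
    triv : Trivial (enc ⟨01⟩ ⟨11⟩ B)
    triv v k v∈L k∈K in-B = v≡⊥ , proj₂ (trivial-B ⊥ k (λ l _ → dot-⊥ˡ l) k∈K (inSpan k-span))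
      where
      v-span : ∀ i → dev (enc ⟨01⟩ ⟨10⟩ B) v ⊥ i ≡ false
      v-span i with lookup B i | InSpan.at in-B i
      ... | true  | eq = eq
      ... | false | _  = lookup-⊥ i
      v≡⊥ : v ≡ ⊥
      v≡⊥ = proj₁ (trivial-B v ⊥ v∈L K-⊥ (inSpan v-span))
      k-span : ∀ i → dev (enc ⟨01⟩ ⟨10⟩ B) ⊥ k i ≡ false
      k-span i with lookup B i | InSpan.at in-B i
      ... | true  | _  = lookup-⊥ i
      ... | false | eq = trans (sym (xor-false⇒≡ eq)) (trans (cong (λ z → lookup z i) v≡⊥) (lookup-⊥ i))

  first : ∀ (v k : Subset n) → zipWith (λ a _ → a) v k ≡ v
  first v k = vec-ext λ i → lookup-zipWith (λ a _ → a) i v k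

  second : ∀ (v k : Subset n) → zipWith (λ _ b → b) v k ≡ k
  second v k = vec-ext λ i → lookup-zipWith (λ _ b → b) i v k

  open TwoLetters {⟨11⟩} {⟨10⟩} (λ ()) (M +ₗ ⊤) +⇔ using () renaming (Δ-exchange to +-exchange; module Parity to +-Parity)
  open TwoLetters {⟨01⟩} {⟨11⟩} (λ ()) (M *̄ ⊤) *⇔ using () renaming (Δ-exchange to *-exchange; module Parity to *-Parity)

  third⟨01⟩ : ∀ v k → k ≡ (v ∧ k) xor ((v xor k) ∧ k)
  third⟨01⟩ false false = refl
  third⟨01⟩ false true  = refl
  third⟨01⟩ true  false = refl
  third⟨01⟩ true  true  = refl

  third⟨10⟩ : ∀ v k → v ≡ (v ∧ k) xor (v ∧ (v xor k))
  third⟨10⟩ false k     = refl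
  third⟨10⟩ true  false = refl
  third⟨10⟩ true  true  = refl

  open +-Parity (λ _ k → k) (λ _ _ _ _ → refl) third⟨01⟩ using () renaming (orthogonal⇒even to +-even⇐; even⇒orthogonal to +-even⇒)
  open *-Parity (λ v _ → v) (λ _ _ _ _ → refl) third⟨10⟩ using () renaming (orthogonal⇒even to *-even⇐; even⇒orthogonal to *-even⇒)

  +-Δ : IsΔMatroid (M +ₗ ⊤)
  +-Δ = (B , B∈+) , +-exchange

  *-Δ : IsΔMatroid (M *̄ ⊤)
  *-Δ = (B , B∈*) , *-exchange
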